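{- There is a deterministic online exploration algorithm with advice that, for every tadpole graph $G$ on $n$ vertices with positive edge weights and every starting vertex $s$, given a suitable advice string of $\lceil \log_2 n\rceil+1$ bits, explores $G$ with cost exactly $\mathrm{cost}_{\mathrm{opt}}(G,s)$ (competitive ratio $1$).
   Context: A tadpole graph is a connected undirected graph consisting of a cycle (at least 3 vertices) together with a path (the stem, at least 1 vertex), one endpoint of which is joined by an edge to one cycle vertex (the junction); exactly one vertex has degree 1, exactly one has degree 3, others degree 2. Each edge $e$ has positive weight $c(e)$. Online exploration model: vertices have unique identifiers; a searcher starts at $s$ knowing only $s$; upon arriving at $v$ it learns identifiers of all neighbours of $v$ and weights of all incident edges; each edge traversal costs its weight; the searcher must perform a closed walk from $s$ visiting all vertices and returning to $s$. $\mathrm{cost}_{\mathrm{opt}}(G,s)$ is the minimum cost of such a closed walk. Advice model: before the exploration starts, an oracle that knows the entire graph, the starting vertex and the (deterministic) algorithm gives the searcher a bit string (the advice), which the algorithm may use in its decisions.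
   Formalization: The edge weights are taken to be positive rational numbers rather than arbitrary positive real numbers. -}

module Defs where

open import Data.Nat using (ℕ; zero; suc; _≤_)
import Data.Nat
open import Data.Nat.Logarithm using (⌈log₂_⌉)
open import Data.Rational using (ℚ; 0ℚ; _+_; _<_) renaming (_≤_ to _≤ℚ_)
open import Data.Bool using (Bool)
open import Data.Maybe using (Maybe; just; nothing; fromMaybe)
import Data.Maybe as Maybe
open import Data.List using (List; []; _∷_; _++_; map; reverse; length; mapMaybe)
open import Data.List.Membership.Propositional using (_∈_)
open import Data.List.Relation.Unary.All using (All)
open import Data.List.Relation.Unary.Linked using (Linked)
open import Data.List.Relation.Binary.Permutation.Propositional using (_↭_)
open import Data.Product using (Σ; ∃; ∃-syntax; _×_; _,_)
open import Data.Sum using (_⊎_)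
open import Function.Bundles using (_⇔_)
open import Relation.Binary.PropositionalEquality using (_≡_)

-- Weighted graphs on vertex identifiers (identifiers are natural numbers).
-- The vertex list is strictly increasing (so identifiers are unique and the
-- list is a canonical enumeration of the vertex set).  w u v = just c means
-- there is an edge {u,v} of weight c.  Weights are positive rationals.

record WGraph : Set where
  field
    V      : List ℕ
    sorted : Linked Data.Nat._<_ V
    w      : ℕ → ℕ → Maybe ℚ
    w-sym  : ∀ u v → w u v ≡ w v u
    w-pos  : ∀ u v c → w u v ≡ just c → 0ℚ < c
open WGraph public

Adj : WGraph → ℕ → ℕ → Set
Adj G u v = ∃[ c ] (w G u v ≡ just c)

-- Tadpole graphs: a cycle c ∷ cs (at least 3 vertices) and a stem p ∷ ps
-- (at least 1 vertex) whose endpoint p is joined to the junction c.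

lastOf : ℕ → List ℕ → ℕ
lastOf x []       = x
lastOf x (y ∷ ys) = lastOf y ys

consec : List ℕ → List (ℕ × ℕ)
consec (x ∷ y ∷ r) = (x , y) ∷ consec (y ∷ r)
consec _           = []

tadEdges : ℕ → List ℕ → ℕ → List ℕ → List (ℕ × ℕ)
tadEdges c cs p ps =
  consec (c ∷ cs) ++ ((lastOf c cs , c) ∷ (c , p) ∷ consec (p ∷ ps))

TadEdge : ℕ → List ℕ → ℕ → List ℕ → ℕ → ℕ → Set
TadEdge c cs p ps u v = ((u , v) ∈ tadEdges c cs p ps) ⊎ ((v , u) ∈ tadEdges c cs p ps)

IsTadpole : WGraph → Set
IsTadpole G =
  Σ ℕ λ c → Σ (List ℕ) λ cs → Σ ℕ λ p → Σ (List ℕ) λ ps →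
    (2 ≤ length cs) ×
    (V G ↭ ((c ∷ cs) ++ (p ∷ ps))) ×
    (∀ u v → (Adj G u v ⇔ TadEdge c cs p ps u v))

weight : WGraph → ℕ → ℕ → ℚ
weight G u v = fromMaybe 0ℚ (w G u v)

cost : WGraph → List ℕ → ℚ
cost G (x ∷ y ∷ r) = weight G x y + cost G (y ∷ r)
cost G _           = 0ℚ

ClosedTour : WGraph → ℕ → List ℕ → Set
ClosedTour G s rest =
  Linked (Adj G) (s ∷ rest) × (lastOf s rest ≡ s) × All (λ v → v ∈ (s ∷ rest)) (V G)

OptimalTour : WGraph → ℕ → List ℕ → Set
OptimalTour G s rest =
  ClosedTour G s rest × (∀ rest′ → ClosedTour G s rest′ → cost G (s ∷ rest) ≤ℚ cost G (s ∷ rest′))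

-- Online exploration with advice.
-- Upon arriving at v the searcher learns v's identifier and the list of
-- (neighbour identifier, edge weight) pairs, listed in increasing order of
-- identifiers (a canonical presentation carrying no extra information).

Obs : Set
Obs = ℕ × List (ℕ × ℚ)

observe : WGraph → ℕ → Obs
observe G v = v , mapMaybe (λ u → Maybe.map (λ c → (u , c)) (w G v u)) (V G)

data Move : Set where
  stop : Move
  go   : ℕ → Move

-- A deterministic algorithm with advice: given the advice string and the
-- sequence of observations made so far (one per visited position of the
-- walk, in order), it either stops or moves to a vertex identifier.
Algorithm : Set
Algorithm = List Bool → List Obs → Move

-- Execute for at most `fuel` moves; hist is the walk so far, reversed.
-- Returns the full walk (in order) if the algorithm stops within fuel.
run : Algorithm → List Bool → WGraph → ℕ → List ℕ → Maybe (List ℕ)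
run A a G fuel hist with A a (map (observe G) (reverse hist))
... | stop = just (reverse hist)
... | go u with fuel
...   | zero   = nothing
...   | suc f  = run A a G f (u ∷ hist)

ExploresOptimally : Algorithm → List Bool → WGraph → ℕ → Set
ExploresOptimally A a G s =
  ∃[ fuel ] ∃[ rest ] ((run A a G fuel (s ∷ []) ≡ just (s ∷ rest)) × OptimalTour G s rest)

adviceBits : ℕ → ℕ
adviceBits n = ⌈log₂ n ⌉ Data.Nat.+ 1

{-# OPTIONS --safe #-}
module Submission where

-- Sort the neighbours of every vertex cyclically.  Arriving at y from x, the
-- searcher leaves along the successor of x in the list of y, and stops as soon
-- as it is about to repeat a directed edge (dart): it traces a face.
--
-- An optimal tour either runs once around the cycle and twice along the stem,
-- or omits one cycle edge e and traverses every other edge twice: if a closed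
-- tour omits e, each remaining edge is a bridge of G − e and is crossed in both
-- directions.  The first kind of tour is a face of G, once the cycle is oriented
-- according to the rotation at the junction; the second is the unique face of
-- the tree G − e.
--
-- The face of G − e has 2n − 2 darts, and the searcher following it meets both
-- ends of e, where plain tracing of G would propose e.  Hence e can be named by
-- the number t < 2n − 2 of moves before e is first proposed.  The face of G
-- contains the first or the second dart at s, which gives two further codes, so
-- 2n ≤ 2 ^ (⌈log₂ n⌉ + 1) codes suffice.

open import Defs
open import Data.Bool using (Bool; true; false; if_then_else_)
open import Data.Empty using (⊥)
open import Data.List using (List; []; _∷_; _++_; [_]; map; reverse; length; filter; mapMaybe; initLast; _∷ʳ′_)
open import Data.List.Properties using (map-∘; map-id; length-map; length-++; length-reverse; reverse-map; reverse-++; reverse-involutive; unfold-reverse; ++-assoc; ++-identityʳ; filter-++; filter-≐; ∷-injective)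
open import Data.List.Membership.Propositional using (_∈_; _∉_; find)
open import Data.List.Membership.Propositional.Properties using (∈-∃++; ∈-++⁺ˡ; ∈-++⁺ʳ; ∈-++⁻; ∈-filter⁺; ∈-filter⁻; ∈-map⁺; ∈-map⁻; ∈-insert)
open import Data.List.Membership.Propositional.Properties.WithK using (unique∧set⇒bag)
open import Data.List.Relation.Binary.BagAndSetEquality using (∼bag⇒↭)
open import Data.List.Relation.Binary.Disjoint.Propositional using (Disjoint)
open import Data.List.Relation.Binary.Permutation.Propositional using (_↭_; prep; ↭-sym; ↭-refl; ↭-trans; ↭⇒↭ₛ)
open import Data.List.Relation.Binary.Permutation.Propositional.Properties using (∈-resp-↭; ++-comm; ++⁺ʳ; ↭-length; ↭-reverse; drop-mid; ↭-singleton-inv)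
import Data.List.Relation.Binary.Permutation.Setoid.Properties as Permₛ
open import Data.List.Relation.Unary.All as All using (All; []; _∷_; all?)
open import Data.List.Relation.Unary.All.Properties using (¬All⇒Any¬)
open import Data.List.Relation.Unary.AllPairs as AllPairs using (AllPairs; []; _∷_)
import Data.List.Relation.Unary.AllPairs.Properties as AllPairs
open import Data.List.Relation.Unary.Any using (here; there)
open import Data.List.Relation.Unary.Linked using (Linked; []; [-]; _∷_)
open import Data.List.Relation.Unary.Linked.Properties using (Linked⇒AllPairs)
open import Data.List.Relation.Unary.Unique.Propositional using (Unique)
open import Data.List.Relation.Unary.Unique.Propositional.Properties as Unique using (Unique[x∷xs]⇒x∉xs)
open import Data.Maybe as Maybe using (Maybe; just; nothing; fromMaybe)
open import Data.Nat using (ℕ; zero; suc; _+_; _*_; _^_; _≤_; _<_; z≤n; s≤s; s≤s⁻¹; ⌈_/2⌉; ⌊_/2⌋)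
open import Data.Nat.Induction using (<-wellFounded)
open import Data.Nat.Logarithm using (⌈log₂_⌉)
open import Data.Nat.Logarithm.Core using (⌈log2⌉)
open import Data.Nat.Properties using (_≟_; m≤n⇒∃[o]m+o≡n; ⌈n/2⌉<n; ⌊n/2⌋+⌈n/2⌉≡n; ⌊n/2⌋≤⌈n/2⌉; +-mono-≤; *-monoʳ-≤; ≤-trans; ≤-reflexive; ≤-refl; +-identityʳ; +-comm; +-suc; _<?_; ≮⇒≥; +-cancelˡ-<; <⇒≢; <-irrefl; <-trans; m<m+n; m≤n⇒m≤1+n; n≤1+n)
open import Data.Nat.Tactic.RingSolver using (solve-∀)
open import Data.Product as Product using (Σ; ∃; ∃-syntax; ∃₂; _×_; _,_; proj₁; proj₂; swap)
open import Data.Product.Properties using (≡-dec)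
open import Data.Rational using (ℚ; 0ℚ) renaming (_+_ to _+ℚ_; _≤_ to _≤ℚ_)
import Data.Rational.Properties as ℚ
open import Data.Sum as Sum using (_⊎_; inj₁; inj₂; [_,_]′)
open import Data.Unit using (⊤; tt)
open import Function using (_∘_; case_of_)
open import Function.Bundles using (mk⇔; module Equivalence)
open import Induction.WellFounded using (Acc; acc)
open import Relation.Binary.Definitions using (DecidableEquality)
open import Relation.Binary.PropositionalEquality using (_≡_; _≢_; refl; sym; trans; cong; cong₂; subst; setoid)
open import Relation.Nullary using (¬_; Dec; yes; no; does; ¬?; _⊎-dec_; contradiction)
open import Relation.Nullary.Decidable using (dec-true; dec-false)

-- Darts, rotations and the algorithm.

Dart : Set
Dart = ℕ × ℕ

_≟ᵈ_ : DecidableEquality Dart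
_≟ᵈ_ = ≡-dec _≟_ _≟_

open import Data.List.Membership.DecPropositional _≟_ using () renaming (_∈?_ to _∈ℕ?_)
open import Data.List.Membership.DecPropositional _≟ᵈ_ using (_∈?_)

hd : List ℕ → ℕ
hd []      = 0
hd (x ∷ _) = x

after : ℕ → List ℕ → List ℕ
after x []      = []
after x (y ∷ l) with x ≟ y
... | yes _ = l
... | no  _ = after x l

-- The cyclic successor of `x`: appending `l` wraps around when `x` comes last. On a one-element
-- list it returns `x` itself, so tracing turns back at a dead end.
rot : ℕ → List ℕ → ℕ
rot x l = hd (after x l ++ l)

Same : Dart → Dart → Set
Same e d = (d ≡ e) ⊎ (d ≡ swap e)

same? : ∀ e d → Dec (Same e d)
same? e d = (d ≟ᵈ e) ⊎-dec (d ≟ᵈ swap e)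

-- The algorithm keeps its observations with the most recent one first.

allowed : Maybe Dart → Obs → List ℕ
allowed nothing  (v , ns) = map proj₁ ns
allowed (just e) (v , ns) = filter (λ u → ¬? (same? e (v , u))) (map proj₁ ns)

propose : Bool → Maybe Dart → List Obs → ℕ
propose b     f []           = 0
propose false f (o ∷ [])     = hd (allowed f o)
propose true  f (o ∷ [])     = rot (hd (allowed f o)) (allowed f o)
propose b     f (o ∷ o′ ∷ _) = rot (proj₁ o′) (allowed f o)

-- The algorithm remembers nothing but the history, so the edge is recomputed from the part of the
-- history of length `t + 1`, at which `t` moves had been made. A shorter history bans nothing.
banned : ℕ → List Obs → Maybe Dart
banned t []      = nothing
banned t (o ∷ h) with length h ≟ t
... | yes _ = just (proj₁ o , propose false nothing (o ∷ h))
... | no  _ = banned t h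

-- Codes 0 and 1 differ only in the first move; code t + 2 means that the edge
-- proposed after t moves is to be avoided from then on.
next : ℕ → List Obs → ℕ
next 0             h = propose false nothing h
next 1             h = propose true nothing h
next (suc (suc t)) h = propose false (banned t h) h

decide : ℕ → List Obs → Move
decide k []      = stop
decide k (o ∷ h) =
  -- The history is reversed, and so are its consecutive pairs: the test asks whether the dart about
  -- to be made has been traversed before.
  if does ((next k (o ∷ h) , proj₁ o) ∈? consec (map proj₁ (o ∷ h)))
  then stop else go (next k (o ∷ h))

decode : List Bool → ℕ
decode []          = 0
decode (false ∷ a) = decode a
decode (true ∷ a)  = 2 ^ length a + decode a

explore : Algorithm
explore a obs = decide (decode a) (reverse obs)

-- Advice strings

encode : ∀ len k → k < 2 ^ len → ∃[ a ] (length a ≡ len × decode a ≡ k)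
encode zero zero _ = [] , refl , refl
encode zero (suc k) (s≤s ())
encode (suc len) k k< with k <? 2 ^ len
... | yes k<′ with encode len k k<′
...   | a , refl , eq = false ∷ a , refl , eq
encode (suc len) k k< | no k≮ with m≤n⇒∃[o]m+o≡n (≮⇒≥ k≮)
... | d , refl with encode len d (+-cancelˡ-< (2 ^ len) d (2 ^ len)
                   (subst (λ m → 2 ^ len + d < 2 ^ len + m) (+-identityʳ (2 ^ len)) k<))
...   | a , refl , refl = true ∷ a , refl , refl

-- Mirrors the recursion of `⌈log2⌉`, which passes from `2 + n` to `1 + ⌈ n /2⌉` and adds one;
-- doubling makes up for the halving because `⌊ n /2⌋ ≤ ⌈ n /2⌉`.
n≤2^⌈log2⌉ : ∀ n (rs : Acc _<_ n) → n ≤ 2 ^ ⌈log2⌉ n rs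
n≤2^⌈log2⌉ zero          _        = z≤n
n≤2^⌈log2⌉ (suc zero)    _        = ≤-refl
n≤2^⌈log2⌉ (suc (suc n)) (acc rs) = ≤-trans
  (subst (λ m → 2 + m ≤ 2 * suc ⌈ n /2⌉) (⌊n/2⌋+⌈n/2⌉≡n n) bound)
  (*-monoʳ-≤ 2 (n≤2^⌈log2⌉ (suc ⌈ n /2⌉) (rs (⌈n/2⌉<n n))))
  where
  bound : 2 + (⌊ n /2⌋ + ⌈ n /2⌉) ≤ 2 * suc ⌈ n /2⌉
  bound = ≤-trans (s≤s (s≤s (+-mono-≤ (⌊n/2⌋≤⌈n/2⌉ n) (≤-refl {⌈ n /2⌉}))))
    (≤-reflexive (cong suc (trans (sym (+-suc ⌈ n /2⌉ ⌈ n /2⌉))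
      (cong (λ m → ⌈ n /2⌉ + suc m) (sym (+-identityʳ ⌈ n /2⌉))))))

2n≤2^adviceBits : ∀ n → n + n ≤ 2 ^ adviceBits n
2n≤2^adviceBits n rewrite +-comm ⌈log₂ n ⌉ 1 | +-identityʳ (2 ^ ⌈log₂ n ⌉) =
  +-mono-≤ (n≤2^⌈log2⌉ n (<-wellFounded n)) (n≤2^⌈log2⌉ n (<-wellFounded n))

-- Walks and the execution of the algorithm.

data Walk (f : List ℕ → ℕ) : List ℕ → List Dart → Dart → Set where
  -- The last index is the dart proposed after the listed darts; it is not made. The stopping rule
  -- is kept out of walks and enters in `run-walk`.
  end  : ∀ {u h z} → f (u ∷ h) ≡ z → Walk f (u ∷ h) [] (u , z)
  move : ∀ {u h z D d} → f (u ∷ h) ≡ z → Walk f (z ∷ u ∷ h) D d →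
         Walk f (u ∷ h) ((u , z) ∷ D) d

nextAt : WGraph → ℕ → List ℕ → ℕ
nextAt G k h = next k (map (observe G) h)

run-stop : ∀ A a G fuel h → A a (map (observe G) (reverse h)) ≡ stop →
           run A a G fuel h ≡ just (reverse h)
run-stop A a G fuel h eq rewrite eq = refl

run-go : ∀ A a G fuel h {u} → A a (map (observe G) (reverse h)) ≡ go u →
         run A a G (suc fuel) h ≡ run A a G fuel (u ∷ h)
run-go A a G fuel h eq rewrite eq = refl

explore-decide : ∀ a G h →
  explore a (map (observe G) (reverse h)) ≡ decide (decode a) (map (observe G) h)
explore-decide a G h = cong (decide (decode a))
  (trans (cong reverse (reverse-map (observe G) h)) (reverse-involutive (map (observe G) h)))

observed : ∀ G h → map proj₁ (map (observe G) h) ≡ h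
observed G h = trans (sym (map-∘ h)) (map-id h)

decide-stop : ∀ G k u h → (nextAt G k (u ∷ h) , u) ∈ consec (u ∷ h) →
              decide k (map (observe G) (u ∷ h)) ≡ stop
decide-stop G k u h m
  rewrite observed G h
        | dec-true ((nextAt G k (u ∷ h) , u) ∈? consec (u ∷ h)) m = refl

decide-go : ∀ G k u h → (nextAt G k (u ∷ h) , u) ∉ consec (u ∷ h) →
            decide k (map (observe G) (u ∷ h)) ≡ go (nextAt G k (u ∷ h))
decide-go G k u h m
  rewrite observed G h
        | dec-false ((nextAt G k (u ∷ h) , u) ∈? consec (u ∷ h)) m = refl

-- The walk h lists the latest vertex first, so consec h holds reversed darts.
run-walk : ∀ G a {h D d} → Walk (nextAt G (decode a)) h D d → Unique D →
  (∀ {e} → e ∈ D → swap e ∉ consec h) → d ∈ D ⊎ swap d ∈ consec h →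
  run explore a G (length D) h ≡ just (reverse h ++ map proj₂ D)
run-walk G a {h = u ∷ h} (end refl) uq new (inj₂ m) =
  trans (run-stop explore a G 0 (u ∷ h)
          (trans (explore-decide a G (u ∷ h)) (decide-stop G (decode a) u h m)))
        (cong just (sym (++-identityʳ _)))
run-walk G a {h = u ∷ h} {D = (_ , z) ∷ D} {d} (move refl W) (u∉ ∷ uq) new old =
  trans (run-go explore a G (length D) (u ∷ h)
          (trans (explore-decide a G (u ∷ h)) (decide-go G (decode a) u h (new (here refl)))))
  (trans (run-walk G a W uq new′ old′) (cong just shuffle))
  where
  new′ : ∀ {e} → e ∈ D → swap e ∉ consec (z ∷ u ∷ h)
  new′ m (here refl) = All.lookup u∉ m refl
  new′ m (there m′)  = new (there m) m′
  old′ : d ∈ D ⊎ swap d ∈ consec (z ∷ u ∷ h)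
  old′ = case old of λ where
    (inj₁ (here refl)) → inj₂ (here refl)
    (inj₁ (there m))   → inj₁ m
    (inj₂ m)           → inj₂ (there m)
  shuffle : reverse (z ∷ u ∷ h) ++ map proj₂ D ≡ reverse (u ∷ h) ++ z ∷ map proj₂ D
  shuffle = trans (cong (_++ map proj₂ D) (unfold-reverse z (u ∷ h)))
                  (++-assoc (reverse (u ∷ h)) [ z ] (map proj₂ D))

walk-consec : ∀ {f u h D d} → Walk f (u ∷ h) D d → consec (u ∷ map proj₂ D) ≡ D
walk-consec (end _)    = refl
walk-consec (move _ W) = cong (_ ∷_) (walk-consec W)

walk-last : ∀ {f u h D d} → Walk f (u ∷ h) D d → lastOf u (map proj₂ D) ≡ proj₁ d
walk-last (end _)    = refl
walk-last (move _ W) = walk-last W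

-- Weights of dart lists

sumW : WGraph → List Dart → ℚ
sumW G []            = 0ℚ
sumW G ((u , v) ∷ D) = weight G u v +ℚ sumW G D

cost-consec : ∀ G l → cost G l ≡ sumW G (consec l)
cost-consec G []          = refl
cost-consec G (x ∷ [])    = refl
cost-consec G (x ∷ y ∷ l) = cong (weight G x y +ℚ_) (cost-consec G (y ∷ l))

weight-nonneg : ∀ G u v → 0ℚ ≤ℚ weight G u v
weight-nonneg G u v with w G u v in eq
... | just c  = ℚ.<⇒≤ (w-pos G u v c eq)
... | nothing = ℚ.≤-refl

sumW-nonneg : ∀ G D → 0ℚ ≤ℚ sumW G D
sumW-nonneg G []            = ℚ.≤-refl
sumW-nonneg G ((u , v) ∷ D) =
  subst (_≤ℚ sumW G ((u , v) ∷ D)) (ℚ.+-identityˡ 0ℚ) (ℚ.+-mono-≤ (weight-nonneg G u v) (sumW-nonneg G D))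

sumW-++ : ∀ G D E → sumW G (D ++ E) ≡ sumW G D +ℚ sumW G E
sumW-++ G []      E = sym (ℚ.+-identityˡ _)
sumW-++ G ((u , v) ∷ D) E =
  trans (cong (weight G u v +ℚ_) (sumW-++ G D E)) (sym (ℚ.+-assoc (weight G u v) (sumW G D) (sumW G E)))

sumW-mid : ∀ G D d E → sumW G (D ++ d ∷ E) ≡ sumW G (d ∷ D ++ E)
sumW-mid G []            d       E = refl
sumW-mid G ((x , y) ∷ D) (u , v) E =
  trans (cong (weight G x y +ℚ_) (sumW-mid G D (u , v) E))
  (trans (sym (ℚ.+-assoc (weight G x y) (weight G u v) _))
  (trans (cong (_+ℚ sumW G (D ++ E)) (ℚ.+-comm (weight G x y) (weight G u v)))
         (ℚ.+-assoc (weight G u v) (weight G x y) _)))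

-- The tool for all comparisons of cost: each dart of `F` is matched with an occurrence of its own
-- in `D`, since `F` has no repetition, and what remains of `D` has nonnegative weight.
sumW-⊆ : ∀ G {F D} → Unique F → (∀ {d} → d ∈ F → d ∈ D) → sumW G F ≤ℚ sumW G D
sumW-⊆ G {[]}          {D} _         _   = sumW-nonneg G D
sumW-⊆ G {(u , v) ∷ F} {D} (d∉ ∷ uq) F⊆D with ∈-∃++ (F⊆D (here refl))
... | D₁ , D₂ , refl = subst (_ ≤ℚ_) (sym (sumW-mid G D₁ (u , v) D₂))
  (ℚ.+-mono-≤ (ℚ.≤-refl {weight G u v}) (sumW-⊆ G uq sub))
  where
  sub : ∀ {d} → d ∈ F → d ∈ D₁ ++ D₂
  sub m with ∈-++⁻ D₁ (F⊆D (there m))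
  ... | inj₁ m₁           = ∈-++⁺ˡ m₁
  ... | inj₂ (here refl)  = contradiction refl (All.lookup d∉ m)
  ... | inj₂ (there m₂)   = ∈-++⁺ʳ D₁ m₂

-- Neighbour lists

nb : WGraph → Maybe Dart → ℕ → List ℕ
nb G f v = allowed f (observe G v)

V-unique : ∀ G → Unique (V G)
V-unique G = AllPairs.map <⇒≢ (Linked⇒AllPairs <-trans (sorted G))

module _ (G : WGraph) (v : ℕ) where

  private
    -- An arbitrary list stands in for `V G`, so that induction is possible.
    obsL : List ℕ → List ℕ
    obsL l = map proj₁ (mapMaybe (λ u → Maybe.map (λ c → (u , c)) (w G v u)) l)

    obsL⁻ : ∀ l {u} → u ∈ obsL l → u ∈ l × Adj G v u
    obsL⁻ (x ∷ l) m with w G v x in eq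
    obsL⁻ (x ∷ l) (here refl) | just c  = here refl , c , eq
    obsL⁻ (x ∷ l) (there m)   | just c  = let m′ , a = obsL⁻ l m in there m′ , a
    obsL⁻ (x ∷ l) m           | nothing = let m′ , a = obsL⁻ l m in there m′ , a

    obsL⁺ : ∀ l {u} → u ∈ l → Adj G v u → u ∈ obsL l
    obsL⁺ (x ∷ l) (here refl) (c , eq) rewrite eq = here refl
    obsL⁺ (x ∷ l) (there m) a with w G v x
    ... | just _  = there (obsL⁺ l m a)
    ... | nothing = obsL⁺ l m a

    obsL-unique : ∀ l → Unique l → Unique (obsL l)
    obsL-unique []      _         = []
    obsL-unique (x ∷ l) (x∉ ∷ uq) with w G v x
    ... | just _  = All.tabulate (λ m → All.lookup x∉ (proj₁ (obsL⁻ l m))) ∷ obsL-unique l uq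
    ... | nothing = obsL-unique l uq

  nb⁻ : ∀ {u} → u ∈ nb G nothing v → Adj G v u
  nb⁻ m = proj₂ (obsL⁻ (V G) m)

  nb⁺ : ∀ {u} → u ∈ V G → Adj G v u → u ∈ nb G nothing v
  nb⁺ = obsL⁺ (V G)

  nb-unique : Unique (nb G nothing v)
  nb-unique = obsL-unique (V G) (V-unique G)

  nbE⁻ : ∀ e {u} → u ∈ nb G (just e) v → u ∈ nb G nothing v × ¬ Same e (v , u)
  nbE⁻ e m = ∈-filter⁻ (λ u → ¬? (same? e (v , u))) {xs = nb G nothing v} m

  nbE⁺ : ∀ e {u} → u ∈ nb G nothing v → ¬ Same e (v , u) → u ∈ nb G (just e) v
  nbE⁺ e m = ∈-filter⁺ (λ u → ¬? (same? e (v , u))) m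

  nbE-unique : ∀ e → Unique (nb G (just e) v)
  nbE-unique e = Unique.filter⁺ (λ u → ¬? (same? e (v , u))) nb-unique

Adj-sym : ∀ G {u v} → Adj G u v → Adj G v u
Adj-sym G {u} {v} (c , eq) = c , trans (w-sym G v u) eq

Same-swap : ∀ {e u v} → Same e (u , v) → Same e (v , u)
Same-swap (inj₁ refl) = inj₂ refl
Same-swap (inj₂ refl) = inj₁ refl

-- Cyclic successors

hd∈ : ∀ {x l} → x ∈ l → hd l ∈ l
hd∈ (here _)  = here refl
hd∈ (there _) = here refl

after-here : ∀ x l → after x (x ∷ l) ≡ l
after-here x l with x ≟ x
... | yes _  = refl
... | no x≢x = contradiction refl x≢x

after-there : ∀ {x y} l → x ≢ y → after x (y ∷ l) ≡ after x l
after-there {x} {y} l x≢y with x ≟ y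
... | yes x≡y = contradiction x≡y x≢y
... | no _    = refl

after-mid : ∀ x l m → x ∉ l → after x (l ++ x ∷ m) ≡ m
after-mid x []      m _  = after-here x m
after-mid x (y ∷ l) m x∉ =
  trans (after-there (l ++ x ∷ m) (x∉ ∘ here)) (after-mid x l m (x∉ ∘ there))

unique-mid : ∀ {A : Set} (l : List A) {x m} → Unique (l ++ x ∷ m) → x ∉ l
unique-mid (y ∷ l) (y∉ ∷ _) (here refl) = All.lookup y∉ (∈-insert l) refl
unique-mid (y ∷ l) (_ ∷ uq) (there m)   = unique-mid l uq m

-- The predecessor is the entry just before `u` or, when `u` comes first, the last entry of the
-- list. The second element `v` excludes the one-element list, where `u` precedes itself.
rot-pred : ∀ {l u v} → Unique l → u ∈ l → v ∈ l → v ≢ u →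
           ∃[ z ] (z ∈ l × z ≢ u × rot z l ≡ u)
rot-pred {u = u} uq u∈l v∈l v≢u with ∈-∃++ u∈l
... | l₁ , l₂ , refl with initLast l₁
rot-pred {u = u} uq u∈l v∈l v≢u | _ , l₂ , refl | l ∷ʳ′ z =
  z , ∈-++⁺ˡ (∈-insert l) , z≢u , cong (λ m → hd (m ++ full)) eq
  where
  full = (l ++ [ z ]) ++ u ∷ l₂
  z≢u : z ≢ u
  z≢u refl = unique-mid (l ++ [ z ]) uq (∈-insert l)
  eq : after z full ≡ u ∷ l₂
  eq = trans (cong (after z) (++-assoc l [ z ] (u ∷ l₂)))
             (after-mid z l (u ∷ l₂) (unique-mid l (subst Unique (++-assoc l [ z ] (u ∷ l₂)) uq)))
rot-pred {u = u} uq u∈l v∈l v≢u | _ , l₂ , refl | [] with initLast l₂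
rot-pred uq u∈l (here refl) v≢u | _ , _ , refl | [] | [] = contradiction refl v≢u
... | l ∷ʳ′ z = z , there (∈-insert l) , z≢u , cong (λ m → hd (m ++ u ∷ l ++ [ z ])) eq
  where
  z∉ : z ∉ u ∷ l
  z∉ = unique-mid (u ∷ l) uq
  z≢u : z ≢ u
  z≢u refl = z∉ (here refl)
  eq : after z (u ∷ l ++ [ z ]) ≡ []
  eq = after-mid z (u ∷ l) [] z∉

module _ {P : ℕ → Set} (P? : ∀ u → Dec (P u)) where

  hd-filter : ∀ l → (l ≡ [] ⊎ P (hd l)) → hd (filter P? l) ≡ hd l
  hd-filter []      _ = refl
  hd-filter (x ∷ l) (inj₂ p) with P? x
  ... | yes _ = refl
  ... | no ¬p = contradiction p ¬p

  after-filter : ∀ {x} l → P x → after x (filter P? l) ≡ filter P? (after x l)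
  after-filter []      p = refl
  after-filter {x} (y ∷ l) p with P? y
  ... | yes _ with x ≟ y
  ...   | yes _ = refl
  ...   | no  _ = after-filter l p
  after-filter {x} (y ∷ l) p | no ¬p with x ≟ y
  ...   | yes refl = contradiction p ¬p
  ...   | no  _    = after-filter l p

  -- `after` commutes with filtering at a kept `x`, and a kept successor is still the first entry.
  -- Hence deleting an edge changes no turn except those from or into that edge.
  rot-filter : ∀ {x} l → P x → P (rot x l) → rot x (filter P? l) ≡ rot x l
  rot-filter {x} l px pr =
    trans (cong hd (trans (cong (_++ filter P? l) (after-filter l px)) (sym (filter-++ P? (after x l) l))))
          (hd-filter (after x l ++ l) (inj₂ pr))

-- Chains and faces

-- Both ends are kept outside the list, so that `Chain R d l d` is a cyclic sequence with entries
-- `d ∷ l`.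
data Chain {A : Set} (R : A → A → Set) (x : A) : List A → A → Set where
  link : ∀ {y} → R x y → Chain R x [] y
  _∷_ : ∀ {y l z} → R x y → Chain R y l z → Chain R x (y ∷ l) z

module _ {A : Set} {R : A → A → Set} where

  chain-++ : ∀ {x l y m z} → Chain R x l y → Chain R y m z → Chain R x (l ++ y ∷ m) z
  chain-++ (link r) c = r ∷ c
  chain-++ (r ∷ b) c = r ∷ chain-++ b c

  chain-split : ∀ {x} l {y m z} → Chain R x (l ++ y ∷ m) z → Chain R x l y × Chain R y m z
  chain-split []      (r ∷ c) = link r , c
  chain-split (_ ∷ l) (r ∷ c) = let a , b = chain-split l c in r ∷ a , b

  -- Cut the cyclic sequence at `d′` and join the two pieces at `d`.
  rotate : ∀ {d l d′} → Chain R d l d → d′ ∈ d ∷ l →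
           ∃[ l′ ] (Chain R d′ l′ d′ × (d ∷ l ↭ d′ ∷ l′))
  rotate {l = l} c (here refl) = l , c , ↭-refl
  rotate {d} {d′ = d′} c (there m) with ∈-∃++ m
  ... | P , Q , refl = let a , b = chain-split P c in
    Q ++ d ∷ P , chain-++ b a , ++-comm (d ∷ P) (d′ ∷ Q)

-- One step of face tracing for the rotation system `n`, which will be the neighbour lists of the
-- graph or of the graph without an edge.
data Turn (n : ℕ → List ℕ) : Dart → Dart → Set where
  turn : ∀ {x y z} → rot x (n y) ≡ z → Turn n (x , y) (y , z)

record Face (n : ℕ → List ℕ) (D : List Dart) : Set where
  constructor face
  field
    first  : Dart
    others : List Dart
    list   : D ≡ first ∷ others
    cyclic : Chain (Turn n) first others first
    unique : Unique D

face-from : ∀ {n D d} → Face n D → d ∈ D →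
            ∃[ l ] (Chain (Turn n) d l d × Unique (d ∷ l) × (D ↭ d ∷ l))
face-from (face _ _ refl c uq) m =
  let l , c′ , p = rotate c m in l , c′ , Permₛ.Unique-resp-↭ (setoid Dart) (↭⇒↭ₛ p) uq , p

-- The proposal after a move depends only on the dart of that move, so a chain of turns is a walk
-- whatever the earlier history `h` is.
chain-walk : ∀ {f n} → (∀ x y h → f (y ∷ x ∷ h) ≡ rot x (n y)) →
  ∀ {x y h l d} → Chain (Turn n) (x , y) l d → Walk f (y ∷ x ∷ h) l d
chain-walk F (link (turn eq)) = end (trans (F _ _ _) eq)
chain-walk F (turn eq ∷ c)     = move (trans (F _ _ _) eq) (chain-walk F c)

-- Turning a face into a run of the algorithm.

Achieves : WGraph → ℕ → ℚ → Set
Achieves G s q = ∃[ a ] ((length a ≡ adviceBits (length (V G))) ×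
  ∃[ fuel ] ∃[ rest ] ((run explore a G fuel (s ∷ []) ≡ just (s ∷ rest)) ×
    -- An inequality suffices, as `q` is shown in the end to bound the cost of every closed tour
    -- from below.
    ClosedTour G s rest × (cost G (s ∷ rest) ≤ℚ q)))

linked-consec : ∀ {R : ℕ → ℕ → Set} l → (∀ {u v} → (u , v) ∈ consec l → R u v) → Linked R l
linked-consec []          _ = []
linked-consec (x ∷ [])    _ = [-]
linked-consec (x ∷ y ∷ l) r = r (here refl) ∷ linked-consec (y ∷ l) (r ∘ there)

consec-linked : ∀ {R : ℕ → ℕ → Set} l → Linked R l → ∀ {u v} → (u , v) ∈ consec l → R u v
consec-linked (x ∷ y ∷ l) (r ∷ _) (here refl) = r
consec-linked (x ∷ y ∷ l) (_ ∷ L) (there m)   = consec-linked (y ∷ l) L m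

-- Coverage is by targets, because a tour lists `s` and then the targets of its darts.
Covers : WGraph → List Dart → Set
Covers G D = ∀ {v} → v ∈ V G → ∃[ u ] ((u , v) ∈ D)

achieve : ∀ G {s z l D} k → k < 2 ^ adviceBits (length (V G)) →
  Walk (nextAt G k) [ s ] ((s , z) ∷ l) (s , z) → Unique ((s , z) ∷ l) → D ↭ (s , z) ∷ l →
  (∀ {u v} → (u , v) ∈ D → Adj G u v) → Covers G D → Achieves G s (sumW G D)
achieve G {s} {z} {l} {D} k k< W uq perm sound cover
  with encode (adviceBits (length (V G))) k k<
... | a , len , refl = a , len , length tour , map proj₂ tour
      -- At the start no dart has been traversed, and the dart proposed after the whole tour is its
      -- first one, which stops the run.
      , run-walk G a W uq (λ _ ()) (inj₁ (here refl))
      , (linked-consec (s ∷ map proj₂ tour) (sound ∘ back) , walk-last W , All.tabulate vis)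
      , subst (_≤ℚ _) (sym (trans (cost-consec G (s ∷ map proj₂ tour)) (cong (sumW G) (walk-consec W))))
          (sumW-⊆ G uq (∈-resp-↭ (↭-sym perm)))
  where
  tour = (s , z) ∷ l
  back : ∀ {d} → d ∈ consec (s ∷ map proj₂ tour) → d ∈ D
  back {d} m = ∈-resp-↭ (↭-sym perm) (subst (d ∈_) (walk-consec W) m)
  vis : ∀ {v} → v ∈ V G → v ∈ s ∷ map proj₂ tour
  vis m = there (∈-map⁺ proj₂ (∈-resp-↭ perm (proj₂ (cover m))))

achieve-face : ∀ G {s D} → 1 ≤ length (V G) → Face (nb G nothing) D →
  (∀ {u v} → (u , v) ∈ D → Adj G u v) → Covers G D →
  (s , hd (nb G nothing s)) ∈ D ⊎ (s , rot (hd (nb G nothing s)) (nb G nothing s)) ∈ D →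
  Achieves G s (sumW G D)
achieve-face G {s} {D} n≥1 F sound cover = λ where
    (inj₁ m) → let l , c , uq , p = face-from F m in
      achieve G 0 (≤-trans (s≤s z≤n) two) (move refl (chain-walk (λ _ _ _ → refl) c)) uq p sound cover
    (inj₂ m) → let l , c , uq , p = face-from F m in
      achieve G 1 two (move refl (chain-walk (λ _ _ _ → refl) c)) uq p sound cover
  where
  two : 2 ≤ 2 ^ adviceBits (length (V G))
  two = ≤-trans (+-mono-≤ n≥1 n≥1) (2n≤2^adviceBits (length (V G)))

-- Avoiding an edge

banned-old : ∀ {t} o h → t < length h → banned t (o ∷ h) ≡ banned t h
banned-old {t} o h t< with length h ≟ t
... | yes refl = contradiction t< (<-irrefl refl)
... | no  _    = refl

banned-early : ∀ {t} h → length h ≤ t → banned t h ≡ nothing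
banned-early []      _  = refl
banned-early {t} (o ∷ h) h≤ with length h ≟ t
... | yes refl = contradiction h≤ (<-irrefl refl)
... | no  _    = banned-early h (≤-trans (n≤1+n (length h)) h≤)

banned-now : ∀ o h → banned (length h) (o ∷ h) ≡ just (proj₁ o , propose false nothing (o ∷ h))
banned-now o h with length h ≟ length h
... | yes _ = refl
... | no ne = contradiction refl ne

module _ (G : WGraph) (e : Dart) where

  private
    at : Maybe Dart → List ℕ → ℕ
    at f h = propose false f (map (observe G) h)

    P? : ∀ v u → Dec (¬ Same e (v , u))
    P? v u = ¬? (same? e (v , u))

  rot-nbE : ∀ {x v} → ¬ Same e (v , x) → ¬ Same e (v , rot x (nb G nothing v)) →
            rot x (nb G (just e) v) ≡ rot x (nb G nothing v)
  rot-nbE {x} {v} = rot-filter (P? v) (nb G nothing v)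

  private
    -- The algorithm names the edge from the end where it was proposed, hence possibly by the
    -- opposite dart.
    swap-allowed : ∀ {e′} o → Same e e′ → allowed (just e′) o ≡ allowed (just e) o
    swap-allowed o (inj₁ refl) = refl
    swap-allowed (v , ns) (inj₂ refl) = filter-≐ _ _ ((λ k → k ∘ sw) , (λ k → k ∘ sw′)) (map proj₁ ns)
      where
      sw : ∀ {d} → Same e d → Same (swap e) d
      sw (inj₁ x) = inj₂ x
      sw (inj₂ x) = inj₁ x
      sw′ : ∀ {d} → Same (swap e) d → Same e d
      sw′ (inj₁ x) = inj₂ x
      sw′ (inj₂ x) = inj₁ x

    at-same : ∀ {e′} h → Same e e′ → at (just e′) h ≡ at (just e) h
    at-same []          _ = refl
    at-same (v ∷ [])    s = cong hd (swap-allowed (observe G v) s)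
    at-same (v ∷ x ∷ h) s = cong (rot x) (swap-allowed (observe G v) s)

    -- Excludes an arrival along `e`, so that the vertex the last move came from survives the
    -- filtering.
    Fresh : List ℕ → Set
    Fresh (v ∷ x ∷ _) = ¬ Same e (v , x)
    Fresh _           = ⊤

    at-avoid : ∀ v h → Fresh (v ∷ h) → ¬ Same e (v , at nothing (v ∷ h)) →
               at nothing (v ∷ h) ≡ at (just e) (v ∷ h)
    at-avoid v []      _  ¬s = sym (hd-filter (P? v) (nb G nothing v) (inj₂ ¬s))
    at-avoid v (x ∷ h) fr ¬s = sym (rot-nbE fr ¬s)

    -- At some moment of the walk plain tracing would propose `e`. `now` asks for a dart still to
    -- come, which keeps the number of moves before the attempt below the length of the tour.
    data Attempt : List ℕ → List Dart → Set where
      now   : ∀ {u h d D} → Same e (u , at nothing (u ∷ h)) → Attempt (u ∷ h) (d ∷ D)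
      later : ∀ {h d D} → Attempt (proj₂ d ∷ h) D → Attempt h (d ∷ D)

    obs-length : ∀ {t} h → t < length h → t < length (map (observe G) h)
    obs-length h = subst (_ <_) (sym (length-map (observe G) h))

    -- Once more than `t` vertices are in the history, later observations do not alter what `banned`
    -- finds, so the ban stays in force for the rest of the walk.
    committed : ∀ {t e′ h D d} → t < length h → banned t (map (observe G) h) ≡ just e′ → Same e e′ →
      Walk (at (just e)) h D d → Walk (nextAt G (suc (suc t))) h D d
    committed {h = h} t< fb s (end eq) =
      end (trans (cong (λ f → at f h) fb) (trans (at-same h s) eq))
    committed {h = h} t< fb s (move {z = z} eq W) =
      move (trans (cong (λ f → at f h) fb) (trans (at-same h s) eq))
        (committed (m≤n⇒m≤1+n t<) (trans (banned-old (observe G z) (map (observe G) h) (obs-length h t<)) fb) s W)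

    -- Here `t` counts the moves before the first attempt. Until then nothing is banned, and plain
    -- tracing agrees with tracing without `e`; from then on `e` is banned. The bounds are shifted
    -- by one since `h` lists vertices and `t` counts moves.
    search : ∀ {h D d} → Walk (at (just e)) h D d → Fresh h → All (λ d → ¬ Same e d) D → Attempt h D →
      ∃[ t ] (length h ≤ suc t × suc t < length h + length D × Walk (nextAt G (suc (suc t))) h D d)
    search {h = u ∷ h} {(_ , z) ∷ D} W@(move eq W′) fr (¬s ∷ av) att with same? e (u , at nothing (u ∷ h))
    ... | yes sm = length h , ≤-refl , m<m+n (suc (length h)) (s≤s z≤n)
        , committed ≤-refl
            (subst (λ m → banned m (map (observe G) (u ∷ h)) ≡ just (u , at nothing (u ∷ h)))
              (length-map (observe G) h) (banned-now (observe G u) (map (observe G) h)))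
            sm W
    ... | no ¬sm with att
    ...   | now sm = contradiction sm ¬sm
    ...   | later att′ with search W′ (¬s ∘ Same-swap) av att′
    ...     | t , lo , hi , W″ = t , m≤n⇒m≤1+n (s≤s⁻¹ lo)
        , subst (suc t <_) (cong suc (sym (+-suc (length h) (length D)))) hi
        , move (trans (cong (λ f → at f (u ∷ h))
                  (banned-early (map (observe G) (u ∷ h)) (subst (_≤ t) (sym (length-map (observe G) (u ∷ h))) (s≤s⁻¹ lo))))
                (trans (at-avoid u h fr ¬sm) eq)) W″

    -- After `(x , v)` the walk stands at `v`, where plain tracing proposes the successor of `x`. As
    -- the walk does not end at `v`, a further dart follows, as `now` requires.
    attempted : ∀ {f h D d x v} → Walk f h D d → (x , v) ∈ D → v ≢ proj₁ d →
      Same e (v , rot x (nb G nothing v)) → Attempt h D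
    attempted (move _ (end _))    (here refl) v≢ s = contradiction refl v≢
    attempted (move _ (move _ _)) (here refl) v≢ s = later (now s)
    attempted (move _ W)          (there m)   v≢ s = later (attempted W m v≢ s)

  nbE-sym : (∀ {u v} → Adj G u v → v ∈ V G) → ∀ {u v} → v ∈ nb G (just e) u → u ∈ nb G (just e) v
  nbE-sym inV {u} {v} m with nbE⁻ G u e m
  ... | m′ , ¬s = let adj = Adj-sym G (nb⁻ G u m′) in
    nbE⁺ G v e (nb⁺ G v (inV adj) adj) (¬s ∘ Same-swap)

  -- Since a single face contains all darts of the graph without `e`, the tour enters an end of `e`
  -- also by the edge preceding `e` in the rotation there. Plain tracing then proposes `e`, which
  -- yields the code.
  achieve-skip : ∀ {s D} → (∀ {u v} → Adj G u v → v ∈ V G) → s ∈ V G →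
    Face (nb G (just e)) D →
    (∀ {u v} → (u , v) ∈ D → v ∈ nb G (just e) u) →
    (∀ {u v} → v ∈ nb G (just e) u → (u , v) ∈ D) →
    Covers G D → proj₁ e ≢ proj₂ e → Adj G (proj₁ e) (proj₂ e) →
    suc (suc (length D)) ≡ length (V G) + length (V G) →
    Achieves G s (sumW G D)
  achieve-skip {s} {D} inV s∈V F sound complete cover a≢b adj len
    with face-from F (complete (hd∈ (nbE-sym inV (sound (proj₂ (cover s∈V))))))
  ... | l , c , uq , p = found (search W tt (All.tabulate avoids) attempt)
    where
    tour = (s , hd (nb G (just e) s)) ∷ l
    W : Walk (at (just e)) [ s ] tour (s , hd (nb G (just e) s))
    W = move refl (chain-walk (λ _ _ _ → refl) c)
    avoids : ∀ {d} → d ∈ tour → ¬ Same e d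
    avoids m = proj₂ (nbE⁻ G _ e (sound (∈-resp-↭ (↭-sym p) m)))
    -- The tour enters v along the dart preceding e in the rotation at v, and
    -- does not end there as v ≢ s.
    attempt-at : ∀ {v u} → v ≢ s → Same e (v , u) → Adj G v u → Attempt [ s ] tour
    attempt-at {v} {u} v≢s sm vu
      with cover (inV (Adj-sym G vu))
    ... | x , xv with nbE⁻ G v e (nbE-sym inV (sound xv))
    ... | x∈ , ¬sx with rot-pred (nb-unique G v) (nb⁺ G v (inV vu) vu) x∈ (λ { refl → ¬sx sm })
    ... | z , z∈ , z≢u , eq = attempted W (∈-resp-↭ p zv) v≢s
            (subst (λ y → Same e (v , y)) (sym eq) sm)
      where
      only : ∀ {e : Dart} {u v z} → Same e (v , u) → Same e (v , z) → proj₁ e ≢ proj₂ e → z ≡ u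
      only (inj₁ refl) (inj₁ refl) _ = refl
      only (inj₂ refl) (inj₂ refl) _ = refl
      only (inj₁ refl) (inj₂ eq) ne = contradiction (cong proj₁ eq) ne
      only (inj₂ refl) (inj₁ eq) ne = contradiction (cong proj₁ (sym eq)) ne
      zv : (z , v) ∈ D
      zv = complete (nbE-sym inV (nbE⁺ G v e z∈ (λ s′ → z≢u (only sm s′ a≢b))))
    attempt : Attempt [ s ] tour
    -- The ends of `e` differ, so at least one of them is not `s`.
    attempt with proj₁ e ≟ s
    ... | no a≢s   = attempt-at a≢s (inj₁ refl) adj
    ... | yes refl = attempt-at (a≢b ∘ sym) (inj₂ refl) (Adj-sym G adj)
    found : ∃[ t ] (1 ≤ suc t × suc t < 1 + length tour ×
              Walk (nextAt G (suc (suc t))) [ s ] tour (s , hd (nb G (just e) s))) →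
            Achieves G s (sumW G D)
    found (t , _ , hi , W′) = achieve G (suc (suc t)) bound W′ uq p
      (λ m → nb⁻ G _ (proj₁ (nbE⁻ G _ e (sound m)))) cover
      where
      bound : suc (suc t) < 2 ^ adviceBits (length (V G))
      -- `hi` says that `t + 2` is at most one more than the length of the tour, which is two less
      -- than twice the number of vertices.
      bound = ≤-trans (s≤s (subst (suc (suc t) ≤_) (cong suc (sym (↭-length p))) hi))
                (≤-trans (≤-reflexive len) (2n≤2^adviceBits (length (V G))))

-- Consecutive pairs

consec-++ : ∀ x xs y ys → consec (x ∷ xs ++ y ∷ ys) ≡ consec (x ∷ xs) ++ (lastOf x xs , y) ∷ consec (y ∷ ys)
consec-++ x []        y ys = refl
consec-++ x (x′ ∷ xs) y ys = cong (_ ∷_) (consec-++ x′ xs y ys)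

consec-src : ∀ {u v} l → (u , v) ∈ consec l → u ∈ l
consec-src (x ∷ y ∷ l) (here refl) = here refl
consec-src (x ∷ y ∷ l) (there m)   = there (consec-src (y ∷ l) m)

consec-tgt : ∀ {u v} x l → (u , v) ∈ consec (x ∷ l) → v ∈ l
consec-tgt x (y ∷ l) (here refl) = here refl
consec-tgt x (y ∷ l) (there m)   = there (consec-tgt y l m)

consec-∈ : ∀ {u v} x l → (u , v) ∈ consec (x ∷ l) → u ∈ x ∷ l × v ∈ x ∷ l
consec-∈ x l m = consec-src (x ∷ l) m , there (consec-tgt x l m)

consec-src-init : ∀ {u v} l d → (u , v) ∈ consec (l ++ [ d ]) → u ∈ l
consec-src-init (x ∷ [])    d (here refl) = here refl
consec-src-init (x ∷ y ∷ l) d (here refl) = here refl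
consec-src-init (x ∷ y ∷ l) d (there m)   = there (consec-src-init (y ∷ l) d m)

consec-cover : ∀ {v} x l → v ∈ l → ∃[ u ] ((u , v) ∈ consec (x ∷ l))
consec-cover x (y ∷ l) (here refl) = x , here refl
consec-cover x (y ∷ l) (there m)   = let u , m′ = consec-cover y l m in u , there m′

consec-++ˡ : ∀ {d} l m → d ∈ consec l → d ∈ consec (l ++ m)
consec-++ˡ (x ∷ y ∷ l) m (here refl) = here refl
consec-++ˡ (x ∷ y ∷ l) m (there d∈)  = there (consec-++ˡ (y ∷ l) m d∈)

consec-mid : ∀ l {x y m} → (x , y) ∈ consec (l ++ x ∷ y ∷ m)
consec-mid []          = here refl
consec-mid (z ∷ [])    = there (here refl)
consec-mid (z ∷ t ∷ l) = there (consec-mid (t ∷ l))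

consec-reverse : ∀ {u v} l → (u , v) ∈ consec l → (v , u) ∈ consec (reverse l)
consec-reverse (x ∷ y ∷ l) m rewrite unfold-reverse x (y ∷ l) with m
... | here refl rewrite unfold-reverse y l | ++-assoc (reverse l) [ y ] [ x ] = consec-mid (reverse l)
... | there m′  = consec-++ˡ (reverse (y ∷ l)) [ x ] (consec-reverse (y ∷ l) m′)

Step : ℕ → ℕ → List ℕ → Set
Step u v l = (u , v) ∈ consec l ⊎ (v , u) ∈ consec l

step-sym : ∀ {u v l} → Step u v l → Step v u l
step-sym (inj₁ m) = inj₂ m
step-sym (inj₂ m) = inj₁ m

step-reverse : ∀ {u v} l → Step u v l → Step u v (reverse l)
step-reverse l (inj₁ m) = inj₂ (consec-reverse l m)
step-reverse l (inj₂ m) = inj₁ (consec-reverse l m)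

step-∈ : ∀ {u v} x l → Step u v (x ∷ l) → u ∈ x ∷ l × v ∈ x ∷ l
step-∈ x l (inj₁ m) = consec-∈ x l m
step-∈ x l (inj₂ m) = swap (consec-∈ x l m)

step-head : ∀ {u x} l → x ∉ l → Step x u (x ∷ l) → ∃[ m ] (l ≡ u ∷ m)
step-head (y ∷ l) x∉ (inj₁ (here refl)) = l , refl
step-head (y ∷ l) x∉ (inj₁ (there m))   = contradiction (consec-src (y ∷ l) m) x∉
step-head {x = x} l x∉ (inj₂ m)         = contradiction (consec-tgt x l m) x∉

-- Distinct edges on paths and cycles.

Differ : Dart → Dart → Set
Differ d d′ = ¬ Same d d′

consec-differ : ∀ l → Unique l → AllPairs Differ (consec l)
consec-differ []          _         = []
consec-differ (x ∷ [])    _         = []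
consec-differ (x ∷ y ∷ l) (x∉ ∷ uq) = All.tabulate differ ∷ consec-differ (y ∷ l) uq
  where
  differ : ∀ {d} → d ∈ consec (y ∷ l) → Differ (x , y) d
  differ m (inj₁ refl) = All.lookup x∉ (consec-src (y ∷ l) m) refl
  differ m (inj₂ refl) = All.lookup x∉ (there (consec-tgt y l m)) refl

unique-∷ʳ : ∀ {A : Set} {x : A} {l} → Unique (x ∷ l) → Unique (l ++ [ x ])
unique-∷ʳ {A} {x} {l} uq = Permₛ.Unique-resp-↭ (setoid A) (↭⇒↭ₛ (++-comm [ x ] l)) uq

-- Without its first entry the closed sequence is a path with no repetition. Its edges differ from
-- the one between `c` and `x`, as `x` is not entered again and is left towards `y`. With only two
-- vertices the same edge would be taken back and forth.
cycle-differ : ∀ c l → 2 ≤ length l → Unique (c ∷ l) → AllPairs Differ (consec (c ∷ l ++ [ c ]))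
cycle-differ c (x ∷ []) (s≤s ()) _
cycle-differ c (x ∷ y ∷ l) _ uq@(c∉ ∷ _) with unique-∷ʳ uq
... | uq′@(x∉ ∷ _) = All.tabulate differ ∷ consec-differ (x ∷ y ∷ l ++ [ c ]) uq′
  where
  differ : ∀ {d} → d ∈ consec (x ∷ y ∷ l ++ [ c ]) → Differ (c , x) d
  differ m (inj₁ refl) = All.lookup x∉ (consec-tgt x (y ∷ l ++ [ c ]) m) refl
  differ (here refl) (inj₂ refl) = All.lookup c∉ (there (here refl)) refl
  differ (there m)   (inj₂ refl) = All.lookup x∉ (consec-src (y ∷ l ++ [ c ]) m) refl

lastOf-∷ʳ : ∀ x l y → lastOf x (l ++ [ y ]) ≡ y
lastOf-∷ʳ x []      y = refl
lastOf-∷ʳ x (z ∷ l) y = lastOf-∷ʳ z l y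

lastOf-∈ : ∀ x l → lastOf x l ∈ x ∷ l
lastOf-∈ x []      = here refl
lastOf-∈ x (y ∷ l) = there (lastOf-∈ y l)

-- Rotations at vertices of degree at most three, and paths.

Node : (ℕ → List ℕ) → ℕ → ℕ → ℕ → Set
-- The case `a ≡ b` is allowed and describes a dead end.
Node n x a b = a ∈ n x × b ∈ n x × (∀ {u} → u ∈ n x → u ≡ a ⊎ u ≡ b)

node-sym : ∀ {n x a b} → Node n x a b → Node n x b a
node-sym (a∈ , b∈ , only) = b∈ , a∈ , (λ m → Sum.swap (only m))

-- The list is `a` alone, with `a ≡ b`, or consists of `a` and `b` in either order; a third entry
-- would repeat one of them.
rot-two : ∀ {l a b} → Unique l → a ∈ l → b ∈ l → (∀ {u} → u ∈ l → u ≡ a ⊎ u ≡ b) → rot a l ≡ b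
rot-two {x ∷ []} {a} _ (here refl) (here refl) _ rewrite after-here a [] = refl
rot-two {x ∷ y ∷ []} {a} _ (here refl) (there (here refl)) _ rewrite after-here a [ y ] = refl
rot-two {x ∷ y ∷ []} {a} ((x≢y ∷ _) ∷ _) (there (here refl)) (here refl) _
  rewrite after-there {a} [ a ] (x≢y ∘ sym) | after-here a [] = refl
rot-two {x ∷ y ∷ []} ((x≢y ∷ _) ∷ _) (here refl) (here refl) only with only (there (here refl))
... | inj₁ eq = contradiction (sym eq) x≢y
... | inj₂ eq = contradiction (sym eq) x≢y
rot-two {x ∷ y ∷ []} ((x≢y ∷ _) ∷ _) (there (here refl)) (there (here refl)) only with only (here refl)
... | inj₁ eq = contradiction eq x≢y
... | inj₂ eq = contradiction eq x≢y
rot-two {x ∷ y ∷ z ∷ l} ((x≢y ∷ x≢z ∷ _) ∷ (y≢z ∷ _) ∷ _) _ _ only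
  with only (here refl) | only (there (here refl)) | only (there (there (here refl)))
... | inj₁ refl | inj₁ refl | _         = contradiction refl x≢y
... | inj₁ refl | inj₂ refl | inj₁ refl = contradiction refl x≢z
... | inj₁ refl | inj₂ refl | inj₂ refl = contradiction refl y≢z
... | inj₂ refl | inj₂ refl | _         = contradiction refl x≢y
... | inj₂ refl | inj₁ refl | inj₁ refl = contradiction refl y≢z
... | inj₂ refl | inj₁ refl | inj₂ refl = contradiction refl x≢z

rot-node : ∀ {n x a b} → Unique (n x) → Node n x a b → rot a (n x) ≡ b
rot-node uq (a∈ , b∈ , only) = rot-two uq a∈ b∈ only

-- At a dead end (t empty) the successor of the last vertex of the path
-- c ∷ l ++ t is its predecessor: the tour turns back there.
data Seg (n : ℕ → List ℕ) : ℕ → List ℕ → List ℕ → Set where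
  []  : ∀ {c t} → Seg n c [] t
  _∷_ : ∀ {c x l t} → Node n x c (hd ((l ++ t) ++ [ c ])) → Seg n x l t → Seg n c (x ∷ l) t

-- Uniqueness is asked of `c ∷ l` and of `l ++ t` separately, so that `c` may return in `t`: the
-- cycle is the case `t = [ c ]`, a path with a dead end the case `t = []`.
seg-build : ∀ {n} c l t → Unique (c ∷ l) → Unique (l ++ t) →
  (∀ {v u} → v ∈ l → u ∈ n v → Step v u (c ∷ l ++ t)) →
  (∀ {v u} → v ∈ l → Step v u (c ∷ l ++ t) → u ∈ n v) → Seg n c l t
seg-build c [] t _ _ _ _ = []
seg-build {n} c (x ∷ l) t ((c≢x ∷ c∉) ∷ uq) (x∉ ∷ uq′) from to =
  (to (here refl) (inj₂ (here refl)) , next∈ (l ++ t) (to (here refl)) , only)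
  ∷ seg-build x l t uq uq′ from′ (λ m s → to (there m) (up s))
  where
  up : ∀ {v u} → Step v u (x ∷ l ++ t) → Step v u (c ∷ x ∷ l ++ t)
  up (inj₁ m) = inj₁ (there m)
  up (inj₂ m) = inj₂ (there m)
  next∈ : ∀ m → (∀ {u} → Step x u (c ∷ x ∷ m) → u ∈ n x) → hd (m ++ [ c ]) ∈ n x
  next∈ []      t′ = t′ (inj₂ (here refl))
  next∈ (y ∷ m) t′ = t′ (inj₁ (there (here refl)))
  only : ∀ {u} → u ∈ n x → u ≡ c ⊎ u ≡ hd ((l ++ t) ++ [ c ])
  only m with from (here refl) m
  ... | inj₁ (here refl) = contradiction refl c≢x
  ... | inj₂ (here refl) = inj₁ refl
  ... | inj₁ (there s) with step-head (l ++ t) (λ m → All.lookup x∉ m refl) (inj₁ s)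
  ...   | _ , eq = inj₂ (cong (λ k → hd (k ++ [ c ])) (sym eq))
  only m | inj₂ (there s) = contradiction refl (All.lookup x∉ (consec-tgt x (l ++ t) s))
  from′ : ∀ {v u} → v ∈ l → u ∈ n v → Step v u (x ∷ l ++ t)
  from′ m m′ with from (there m) m′
  ... | inj₁ (here refl) = contradiction refl (All.lookup c∉ m)
  ... | inj₁ (there s)   = inj₁ s
  ... | inj₂ (here refl) = contradiction refl (All.lookup x∉ (∈-++⁺ˡ m))
  ... | inj₂ (there s)   = inj₂ s

record RotThree (l : List ℕ) (a b c : ℕ) : Set where
  constructor rots
  field
    rot-a : rot a l ≡ b
    rot-b : rot b l ≡ c
    rot-c : rot c l ≡ a

rot-list : ∀ {a b c} → a ≢ b → a ≢ c → b ≢ c → RotThree (a ∷ b ∷ c ∷ []) a b c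
rot-list {a} {b} {c} a≢b a≢c b≢c = rots
  (cong (λ m → hd (m ++ l)) (after-mid a [] (b ∷ c ∷ []) (λ ())))
  (cong (λ m → hd (m ++ l)) (after-mid b (a ∷ []) (c ∷ []) (λ { (here e) → a≢b (sym e) })))
  (cong (λ m → hd (m ++ l)) (after-mid c (a ∷ b ∷ []) []
      (λ { (here e) → a≢c (sym e) ; (there (here e)) → b≢c (sym e) })))
  where l = a ∷ b ∷ c ∷ []

rot-cycle : ∀ {l a b c} → RotThree l a b c → RotThree l b c a
rot-cycle (rots p q r) = rots q r p

two-perms : ∀ {l} {a b : ℕ} → l ↭ a ∷ b ∷ [] → l ≡ a ∷ b ∷ [] ⊎ l ≡ b ∷ a ∷ []
two-perms p with ∈-∃++ (∈-resp-↭ (↭-sym p) (here refl))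
... | l₁ , l₂ , refl with l₁ | ↭-singleton-inv (drop-mid l₁ [] p)
...   | []     | refl = inj₁ refl
...   | _ ∷ [] | refl = inj₂ refl

-- The list is a permutation of the three elements. The position of `a` and the order of the other
-- two give six lists, three for each cyclic order.
rot-three : ∀ {l a b c} → Unique l → a ∈ l → b ∈ l → c ∈ l → a ≢ b → a ≢ c → b ≢ c →
  (∀ {u} → u ∈ l → u ∈ a ∷ b ∷ c ∷ []) → RotThree l a b c ⊎ RotThree l c b a
rot-three {l} {a} {b} {c} uq a∈ b∈ c∈ a≢b a≢c b≢c only = cases (∈-∃++ a∈)
  where
  perm : l ↭ a ∷ b ∷ c ∷ []
  perm = ∼bag⇒↭ (unique∧set⇒bag uq ((a≢b ∷ a≢c ∷ []) ∷ (b≢c ∷ []) ∷ [] ∷ []) (mk⇔ only λ where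
    (here refl)                 → a∈
    (there (here refl))         → b∈
    (there (there (here refl))) → c∈))
  flip : ∀ {x y : ℕ} → x ≢ y → y ≢ x
  flip n e = n (sym e)
  cases : (∃₂ λ l₁ l₂ → l ≡ l₁ ++ a ∷ l₂) → RotThree l a b c ⊎ RotThree l c b a
  cases (l₁ , l₂ , refl) with l₁ | l₂ | two-perms (drop-mid l₁ [] perm)
  ... | []         | _ ∷ _ ∷ [] | inj₁ refl = inj₁ (rot-list a≢b a≢c b≢c)
  ... | []         | _ ∷ _ ∷ [] | inj₂ refl = inj₂ (rot-cycle (rot-list a≢c a≢b (flip b≢c)))
  ... | _ ∷ []     | _ ∷ []     | inj₁ refl = inj₂ (rot-cycle (rot-cycle (rot-list (flip a≢b) b≢c a≢c)))
  ... | _ ∷ []     | _ ∷ []     | inj₂ refl = inj₁ (rot-cycle (rot-list (flip a≢c) (flip b≢c) a≢b))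
  ... | _ ∷ _ ∷ [] | []         | inj₁ refl = inj₁ (rot-cycle (rot-cycle (rot-list b≢c (flip a≢b) (flip a≢c))))
  ... | _ ∷ _ ∷ [] | []         | inj₂ refl = inj₂ (rot-list (flip b≢c) (flip a≢c) (flip a≢b))
  ... | _ ∷ _ ∷ _ ∷ _ | _ | inj₁ ()
  ... | _ ∷ _ ∷ _ ∷ _ | _ | inj₂ ()

-- Going along a path and back

loop : ℕ → List ℕ → List Dart
loop c []      = []
loop c (x ∷ l) = (c , x) ∷ loop x l ++ [ (x , c) ]

loop-length : ∀ c l → length (loop c l) ≡ length l + length l
loop-length c []      = refl
loop-length c (x ∷ l) = cong suc (trans (length-++ (loop x l))
  (trans (+-comm (length (loop x l)) 1) (trans (cong suc (loop-length x l)) (sym (+-suc (length l) (length l))))))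

loop⁺ : ∀ {u v} c l → Step u v (c ∷ l) → (u , v) ∈ loop c l
loop⁺ c (x ∷ l) (inj₁ (here refl)) = here refl
loop⁺ c (x ∷ l) (inj₂ (here refl)) = there (∈-++⁺ʳ (loop x l) (here refl))
loop⁺ c (x ∷ l) (inj₁ (there m))   = there (∈-++⁺ˡ (loop⁺ x l (inj₁ m)))
loop⁺ c (x ∷ l) (inj₂ (there m))   = there (∈-++⁺ˡ (loop⁺ x l (inj₂ m)))

loop⁻ : ∀ {u v} c l → (u , v) ∈ loop c l → Step u v (c ∷ l)
loop⁻ c (x ∷ l) (here refl) = inj₁ (here refl)
loop⁻ c (x ∷ l) (there m) with ∈-++⁻ (loop x l) m
... | inj₂ (here refl) = inj₂ (here refl)
... | inj₁ m′ with loop⁻ x l m′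
...   | inj₁ s = inj₁ (there s)
...   | inj₂ s = inj₂ (there s)

loop-touches : ∀ {u v} c l → (u , v) ∈ loop c l → u ∈ l ⊎ v ∈ l
loop-touches c l m with loop⁻ c l m
... | inj₁ s = inj₂ (consec-tgt c l s)
... | inj₂ s = inj₁ (consec-tgt c l s)

loop-unique : ∀ c l → Unique (c ∷ l) → Unique (loop c l)
loop-unique c []      _         = []
loop-unique c (x ∷ l) (c∉ ∷ uq) = All.tabulate ne ∷
  Unique.++⁺ (loop-unique x l uq) ([] ∷ []) disj
  where
  out : ∀ {y} → y ∈ x ∷ l → c ≢ y
  out = All.lookup c∉
  ne : ∀ {d} → d ∈ loop x l ++ [ (x , c) ] → (c , x) ≢ d
  ne m refl with ∈-++⁻ (loop x l) m
  ... | inj₁ m′ = out (proj₁ (step-∈ x l (loop⁻ x l m′))) refl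
  ... | inj₂ (here eq) = out (here refl) (cong proj₁ eq)
  disj : Disjoint (loop x l) [ (x , c) ]
  disj (m , here refl) = out (proj₂ (step-∈ x l (loop⁻ x l m))) refl

loop-disjoint : ∀ {D} c l → (∀ {u v} → (u , v) ∈ D → u ∉ l × v ∉ l) → Disjoint (loop c l) D
loop-disjoint c l out {u , v} (m , m′) =
  [ proj₁ (out m′) , proj₂ (out m′) ]′ (loop-touches c l m)

module _ {n : ℕ → List ℕ} (uq : ∀ x → Unique (n x)) where

  -- Induction on the path: straight on at an inner vertex, back at the dead end. The `Node` at an
  -- inner `x` serves both passages, on the way back with its ends exchanged.
  loop-chain : ∀ {c x l} → Seg n c (x ∷ l) [] → Chain (Turn n) (c , x) (loop x l) (x , c)
  loop-chain {l = []}    (nd ∷ _) = link (turn (rot-node {n} (uq _) nd))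
  loop-chain {l = y ∷ l} (nd ∷ s) = turn (rot-node {n} (uq _) nd) ∷
    chain-++ (loop-chain s) (link (turn (rot-node {n} (uq _) (node-sym {n} nd))))

  loop-then : ∀ {c x l d m d′} → Seg n c (x ∷ l) [] → Turn n (x , c) d → Chain (Turn n) d m d′ →
              Chain (Turn n) (c , x) ((loop x l ++ [ (x , c) ]) ++ d ∷ m) d′
  loop-then {c} {x} {l} {d} {m} s t ch =
    subst (λ k → Chain (Turn n) (c , x) k _) (sym (++-assoc (loop x l) [ (x , c) ] (d ∷ m)))
      (chain-++ (loop-chain s) (t ∷ ch))

  loop-end : ∀ {c x l d} → Seg n c (x ∷ l) [] → Turn n (x , c) d →
             Chain (Turn n) (c , x) (loop x l ++ [ (x , c) ]) d
  loop-end s t = chain-++ (loop-chain s) (link t)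

  arc-chain : ∀ {a x d p} l → Seg n a (x ∷ l) [ d ] → rot (lastOf x l) (n d) ≡ p →
              Chain (Turn n) (a , x) (consec (x ∷ l ++ [ d ])) (d , p)
  arc-chain []      (nd ∷ _) r = turn (rot-node {n} (uq _) nd) ∷ link (turn r)
  arc-chain (y ∷ l) (nd ∷ s) r = turn (rot-node {n} (uq _) nd) ∷ arc-chain l s r

seg-node : ∀ {n a d v} l → Seg n a l [ d ] → v ∈ l →
  ∃₂ λ a′ b′ → Node n v a′ b′ × (v , b′) ∈ consec (a ∷ l ++ [ d ])
seg-node (x ∷ [])    (nd ∷ _) (here refl) = _ , _ , nd , there (here refl)
seg-node (x ∷ y ∷ l) (nd ∷ _) (here refl) = _ , _ , nd , there (here refl)
seg-node (x ∷ l)     (_ ∷ s)  (there m)   =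
  let a′ , b′ , nd , m′ = seg-node l s m in a′ , b′ , nd , there m′

-- Cuts

module _ {P Q : ℕ → Set} (dec : ∀ v → P v ⊎ Q v) (excl : ∀ {v} → P v → Q v → ⊥) where

  leave : ∀ x r {v} → P x → v ∈ x ∷ r → Q v → ∃₂ λ a b → (a , b) ∈ consec (x ∷ r) × P a × Q b
  leave x r       px (here refl) qv = contradiction qv (excl px)
  leave x (y ∷ r) px (there m)   qv with dec y
  ... | inj₂ qy = x , y , here refl , px , qy
  ... | inj₁ py = let a , b , m′ , pq = leave y r py m qv in a , b , there m′ , pq

  arrive : ∀ x r {v} → v ∈ x ∷ r → P v → Q (lastOf x r) → ∃₂ λ a b → (a , b) ∈ consec (x ∷ r) × P a × Q b
  arrive x r       (here refl) pv ql = leave x r pv (lastOf-∈ x r) ql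
  arrive x (y ∷ r) (there m)   pv ql =
    let a , b , m′ , pq = arrive y r m pv ql in a , b , there m′ , pq

-- A walk starting in `P` must leave it to reach `v`; a walk starting in `Q` must get from `u` back
-- to its end `s`, which lies in `Q`.
crossing : ∀ {P Q : ℕ → Set} → (∀ v → P v ⊎ Q v) → (∀ {v} → P v → Q v → ⊥) →
  ∀ s r {u v} → lastOf s r ≡ s → u ∈ s ∷ r → P u → v ∈ s ∷ r → Q v →
  ∃₂ λ a b → (a , b) ∈ consec (s ∷ r) × P a × Q b
crossing {Q = Q} dec excl s r closed u∈ pu v∈ qv with dec s
... | inj₁ ps = leave dec excl s r ps v∈ qv
... | inj₂ qs = arrive dec excl s r u∈ pu (subst Q (sym closed) qs)

module _ {n : ℕ → List ℕ} where

  -- Shows that the edge between `x` and `c` is a bridge. The exit that the recursion finds further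
  -- out leads to `x`, which is still inside.
  seg-exit : ∀ {c a b} x l → Seg n c (x ∷ l) [] → a ∈ x ∷ l → b ∈ n a → b ∈ x ∷ l ⊎ (a ≡ x × b ≡ c)
  seg-exit x []      ((_ , _ , only) ∷ _) (here refl) m with only m
  ... | inj₁ refl = inj₂ (refl , refl)
  ... | inj₂ refl = inj₂ (refl , refl)
  seg-exit x (y ∷ l) ((_ , _ , only) ∷ _) (here refl) m with only m
  ... | inj₁ refl = inj₂ (refl , refl)
  ... | inj₂ refl = inj₁ (there (here refl))
  seg-exit x (y ∷ l) (_ ∷ s) (there a∈) m with seg-exit y l s a∈ m
  ... | inj₁ b∈          = inj₁ (there b∈)
  ... | inj₂ (_ , refl)  = inj₁ (here refl)

  -- The closed tour visits both sides of the bridge between `c` and `x`, so it crosses it in both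
  -- directions; the recursion treats the bridges further out.
  loop⊆tour : ∀ {s r} c l → Unique (c ∷ l) → Seg n c l [] → lastOf s r ≡ s →
    (∀ {v} → v ∈ c ∷ l → v ∈ s ∷ r) →
    (∀ {a b} → (a , b) ∈ consec (s ∷ r) → b ∈ n a × a ∈ n b) →
    ∀ {d} → d ∈ loop c l → d ∈ consec (s ∷ r)
  loop⊆tour {s} {r} c (x ∷ l) (c∉ ∷ uq) seg@(_ ∷ seg′) closed vis adj = λ where
      (here refl) → inward
      (there m)   → [ loop⊆tour x l uq seg′ closed (vis ∘ there) adj , (λ { (here refl) → outward }) ]′
                      (∈-++⁻ (loop x l) m)
    where
    S = x ∷ l
    c∉S : c ∉ S
    c∉S m = All.lookup c∉ m refl
    dec : ∀ v → v ∈ S ⊎ v ∉ S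
    dec v with v ∈ℕ? S
    ... | yes m = inj₁ m
    ... | no ¬m = inj₂ ¬m
    outward : (x , c) ∈ consec (s ∷ r)
    outward with crossing dec (λ m ¬m → ¬m m) s r closed (vis (there (here refl))) (here refl) (vis (here refl)) c∉S
    ... | a , b , m , a∈ , b∉ with seg-exit x l seg a∈ (proj₁ (adj m))
    ...   | inj₁ b∈            = contradiction b∈ b∉
    ...   | inj₂ (refl , refl) = m
    inward : (c , x) ∈ consec (s ∷ r)
    inward with crossing (Sum.swap ∘ dec) (λ ¬m m → ¬m m) s r closed (vis (here refl)) c∉S (vis (there (here refl))) (here refl)
    ... | a , b , m , a∉ , b∈ with seg-exit x l seg b∈ (proj₂ (adj m))
    ...   | inj₁ a∈            = contradiction a∈ a∉
    ...   | inj₂ (refl , refl) = m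

unique-++⁻ : ∀ {A : Set} (l : List A) {m} → Unique (l ++ m) → Unique l × Unique m × Disjoint l m
unique-++⁻ []      uq        = [] , uq , λ { (() , _) }
unique-++⁻ (x ∷ l) (x∉ ∷ uq) with unique-++⁻ l uq
... | ul , um , disj = All.tabulate (λ m → All.lookup x∉ (∈-++⁺ˡ m)) ∷ ul , um , λ where
  (here refl , m) → All.lookup x∉ (∈-++⁺ʳ l m) refl
  (there m , m′)  → disj (m , m′)

unique-∷ : ∀ {A : Set} {x : A} {l} → x ∉ l → Unique l → Unique (x ∷ l)
unique-∷ x∉ uq = All.tabulate (λ { m refl → x∉ m }) ∷ uq

differ-mid : ∀ D {e E} → AllPairs Differ (D ++ e ∷ E) →
             (∀ {d} → d ∈ D → ¬ Same e d) × (∀ {d} → d ∈ E → ¬ Same e d)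
differ-mid []      (e≁ ∷ _) = (λ ()) , All.lookup e≁
differ-mid (d ∷ D) {e} (d≁ ∷ ap) with differ-mid D ap
... | left , right = (λ where
    (here refl) (inj₁ refl) → All.lookup d≁ (∈-insert D) (inj₁ refl)
    (here refl) (inj₂ refl) → All.lookup d≁ (∈-insert D) (inj₂ refl)
    (there m)               → left m) , right

leg : ∀ {n} c l → Unique (c ∷ l) →
  (∀ {v u} → v ∈ l → u ∈ n v → Step v u (c ∷ l)) →
  (∀ {v u} → v ∈ l → Step v u (c ∷ l) → u ∈ n v) → Seg n c l []
leg c l u@(_ ∷ ul) from to = seg-build c l [] u (subst Unique (sym (++-identityʳ l)) ul)
  (λ {v} {u} m m′ → subst (λ k → Step v u (c ∷ k)) (sym (++-identityʳ l)) (from m m′))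
  (λ {v} {u} m s → to m (subst (λ k → Step v u (c ∷ k)) (++-identityʳ l) s))

-- Spiders

-- A centre with three legs, of which `A` and `B` may be empty: the shape of a tadpole without one
-- cycle edge, its legs being the stem and the two remaining parts of the cycle.
module Spider {n : ℕ → List ℕ} (c p : ℕ) (ps A B : List ℕ)
  (uP : Unique (c ∷ p ∷ ps)) (uA : Unique (c ∷ A)) (uB : Unique (c ∷ B))
  (dPA : Disjoint (p ∷ ps) A) (dPB : Disjoint (p ∷ ps) B) (dAB : Disjoint A B)
  (n⁻ : ∀ {v u} → u ∈ n v → Step v u (c ∷ p ∷ ps) ⊎ Step v u (c ∷ A) ⊎ Step v u (c ∷ B))
  (n⁺ : ∀ {v u} → Step v u (c ∷ p ∷ ps) ⊎ Step v u (c ∷ A) ⊎ Step v u (c ∷ B) → u ∈ n v)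
  where

  private
    P = p ∷ ps

  tree : List Dart
  tree = loop c P ++ loop c A ++ loop c B

  tree⁺ : ∀ {u v} → v ∈ n u → (u , v) ∈ tree
  tree⁺ m with n⁻ m
  ... | inj₁ s        = ∈-++⁺ˡ (loop⁺ c P s)
  ... | inj₂ (inj₁ s) = ∈-++⁺ʳ (loop c P) (∈-++⁺ˡ (loop⁺ c A s))
  ... | inj₂ (inj₂ s) = ∈-++⁺ʳ (loop c P) (∈-++⁺ʳ (loop c A) (loop⁺ c B s))

  tree⁻ : ∀ {u v} → (u , v) ∈ tree → v ∈ n u
  tree⁻ m with ∈-++⁻ (loop c P) m
  ... | inj₁ m′ = n⁺ (inj₁ (loop⁻ c P m′))
  ... | inj₂ m′ with ∈-++⁻ (loop c A) m′
  ...   | inj₁ m″ = n⁺ (inj₂ (inj₁ (loop⁻ c A m″)))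
  ...   | inj₂ m″ = n⁺ (inj₂ (inj₂ (loop⁻ c B m″)))

  private
    away : ∀ {l l′} → c ∉ l′ → Disjoint l l′ → ∀ {u v} → (u , v) ∈ loop c l → u ∉ l′ × v ∉ l′
    away {l} c∉ disj m with step-∈ c l (loop⁻ c l m)
    ... | u∈ , v∈ = out u∈ , out v∈
      where
      out : ∀ {u} → u ∈ c ∷ l → u ∉ _
      out (here refl) = c∉
      out (there m)   = λ m′ → disj (m , m′)

    c∉P = Unique[x∷xs]⇒x∉xs uP
    c∉A = Unique[x∷xs]⇒x∉xs uA
    c∉B = Unique[x∷xs]⇒x∉xs uB

  tree-unique : Unique tree
  tree-unique = Unique.++⁺ (loop-unique c P uP)
    (Unique.++⁺ (loop-unique c A uA) (loop-unique c B uB)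
      (loop-disjoint c A (away c∉A (λ (x , y) → dAB (y , x)))))
    (loop-disjoint c P λ m → [ away c∉P (λ (x , y) → dPA (y , x)) , away c∉P (λ (x , y) → dPB (y , x)) ]′
      (∈-++⁻ (loop c A) m))

  private
    not-on : ∀ {v u l} → v ≢ c → v ∉ l → ¬ Step v u (c ∷ l)
    not-on {l = l} v≢c v∉ s with proj₁ (step-∈ c l s)
    ... | here eq = v≢c eq
    ... | there m = v∉ m

    ≢c : ∀ {v l} → c ∉ l → v ∈ l → v ≢ c
    ≢c c∉ m refl = c∉ m

  segP : Seg n c P []
  segP = leg c P uP from (λ _ → n⁺ ∘ inj₁)
    where
    from : ∀ {v u} → v ∈ P → u ∈ n v → Step v u (c ∷ P)
    from m m′ with n⁻ m′
    ... | inj₁ s        = s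
    ... | inj₂ (inj₁ s) = contradiction s (not-on (≢c c∉P m) (λ k → dPA (m , k)))
    ... | inj₂ (inj₂ s) = contradiction s (not-on (≢c c∉P m) (λ k → dPB (m , k)))

  segA : Seg n c A []
  segA = leg c A uA from (λ _ → n⁺ ∘ inj₂ ∘ inj₁)
    where
    from : ∀ {v u} → v ∈ A → u ∈ n v → Step v u (c ∷ A)
    from m m′ with n⁻ m′
    ... | inj₁ s        = contradiction s (not-on (≢c c∉A m) (λ k → dPA (k , m)))
    ... | inj₂ (inj₁ s) = s
    ... | inj₂ (inj₂ s) = contradiction s (not-on (≢c c∉A m) (λ k → dAB (m , k)))

  segB : Seg n c B []
  segB = leg c B uB from (λ _ → n⁺ ∘ inj₂ ∘ inj₂)
    where
    from : ∀ {v u} → v ∈ B → u ∈ n v → Step v u (c ∷ B)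
    from m m′ with n⁻ m′
    ... | inj₁ s        = contradiction s (not-on (≢c c∉B m) (λ k → dPB (k , m)))
    ... | inj₂ (inj₁ s) = contradiction s (not-on (≢c c∉B m) (λ k → dAB (k , m)))
    ... | inj₂ (inj₂ s) = s

  centre : ∀ {u} → u ∈ n c → u ≡ p ⊎ (∃[ m ] (A ≡ u ∷ m)) ⊎ (∃[ m ] (B ≡ u ∷ m))
  centre m with n⁻ m
  ... | inj₁ s        = inj₁ (sym (cong hd (proj₂ (step-head P c∉P s))))
  ... | inj₂ (inj₁ s) = inj₂ (inj₁ (step-head A c∉A s))
  ... | inj₂ (inj₂ s) = inj₂ (inj₂ (step-head B c∉B s))

  tree-cover : ∀ {v} → v ∈ c ∷ P ⊎ v ∈ A ⊎ v ∈ B → ∃[ u ] ((u , v) ∈ tree)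
  tree-cover (inj₁ (here refl)) = p , ∈-++⁺ˡ (loop⁺ c P (inj₂ (here refl)))
  tree-cover (inj₁ (there m))   =
    let u , m′ = consec-cover c P m in u , ∈-++⁺ˡ (loop⁺ c P (inj₁ m′))
  tree-cover (inj₂ (inj₁ m)) =
    let u , m′ = consec-cover c A m in u , ∈-++⁺ʳ (loop c P) (∈-++⁺ˡ (loop⁺ c A (inj₁ m′)))
  tree-cover (inj₂ (inj₂ m)) =
    let u , m′ = consec-cover c B m in u , ∈-++⁺ʳ (loop c P) (∈-++⁺ʳ (loop c A) (loop⁺ c B (inj₁ m′)))

  tree-length : length tree ≡ (length P + length P) + ((length A + length A) + (length B + length B))
  tree-length = trans (length-++ (loop c P)) (cong₂ _+_ (loop-length c P)
    (trans (length-++ (loop c A)) (cong₂ _+_ (loop-length c A) (loop-length c B))))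

  tree⊆tour : ∀ {s r} → lastOf s r ≡ s →
    (∀ {v} → v ∈ c ∷ P ⊎ v ∈ A ⊎ v ∈ B → v ∈ s ∷ r) →
    (∀ {a b} → (a , b) ∈ consec (s ∷ r) → b ∈ n a × a ∈ n b) →
    ∀ {d} → d ∈ tree → d ∈ consec (s ∷ r)
  tree⊆tour closed vis adj m with ∈-++⁻ (loop c P) m
  ... | inj₁ m′ = loop⊆tour c P uP segP closed (vis ∘ inj₁) adj m′
  ... | inj₂ m′ with ∈-++⁻ (loop c A) m′
  ...   | inj₁ m″ = loop⊆tour c A uA segA closed
          (λ { (here refl) → vis (inj₁ (here refl)) ; (there k) → vis (inj₂ (inj₁ k)) }) adj m″
  ...   | inj₂ m″ = loop⊆tour c B uB segB closed
          (λ { (here refl) → vis (inj₁ (here refl)) ; (there k) → vis (inj₂ (inj₂ k)) }) adj m″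

-- The tour runs out and back along each leg and turns at `c` into the next one. With three legs
-- their order must match the rotation at `c`; with two the rotation merely exchanges them.
tree-face : ∀ {n} (uq : ∀ x → Unique (n x)) {c p ps} A B →
  Seg n c (p ∷ ps) [] → Seg n c A [] → Seg n c B [] →
  Unique (loop c (p ∷ ps) ++ loop c A ++ loop c B) →
  (∀ {y A′ x B′} → A ≡ y ∷ A′ → B ≡ x ∷ B′ → RotThree (n c) p y x) →
  (∀ {y A′} → A ≡ y ∷ A′ → B ≡ [] → Node n c p y) →
  (∀ {x B′} → A ≡ [] → B ≡ x ∷ B′ → Node n c p x) →
  1 ≤ length A + length B →
  Face n (loop c (p ∷ ps) ++ loop c A ++ loop c B)
tree-face uq {c} {p} {ps} (y ∷ A) (x ∷ B) sP sA sB u both _ _ _ = face (c , p) _ refl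
  (loop-then uq sP (turn r₁) (loop-then uq sA (turn r₂) (loop-end uq sB (turn r₃)))) u
  where open RotThree (both refl refl) renaming (rot-a to r₁; rot-b to r₂; rot-c to r₃)
tree-face {n} uq {c} {p} {ps} (y ∷ A) [] sP sA sB u _ only _ _ = face (c , p) _ refl
  (subst (λ k → Chain (Turn n) (c , p) ((loop p ps ++ [ (p , c) ]) ++ k) (c , p))
    (sym (++-identityʳ (loop c (y ∷ A))))
    (loop-then uq sP (turn (rot-node {n} (uq c) nd)) (loop-end uq sA (turn (rot-node {n} (uq c) (node-sym {n} nd)))))) u
  where nd = only refl refl
tree-face {n} uq {c} {p} {ps} [] (x ∷ B) sP sA sB u _ _ only _ = face (c , p) _ refl
  (loop-then uq sP (turn (rot-node {n} (uq c) nd)) (loop-end uq sB (turn (rot-node {n} (uq c) (node-sym {n} nd))))) u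
  where nd = only refl refl

-- Tadpoles

record Tadpole (G : WGraph) (c : ℕ) (cs : List ℕ) (p : ℕ) (ps : List ℕ) : Set where
  field
    long  : 2 ≤ length cs
    perm  : V G ↭ (c ∷ cs) ++ (p ∷ ps)
    adj⁻  : ∀ {u v} → Adj G u v → Step u v (c ∷ cs ++ [ c ]) ⊎ Step u v (c ∷ p ∷ ps)
    adj⁺  : ∀ {u v} → Step u v (c ∷ cs ++ [ c ]) ⊎ Step u v (c ∷ p ∷ ps) → Adj G u v

tadEdges-split : ∀ c cs p ps → tadEdges c cs p ps ≡ consec (c ∷ cs ++ [ c ]) ++ consec (c ∷ p ∷ ps)
tadEdges-split c cs p ps = sym (trans (cong (_++ consec (c ∷ p ∷ ps)) (consec-++ c cs c []))
  (++-assoc (consec (c ∷ cs)) [ (lastOf c cs , c) ] (consec (c ∷ p ∷ ps))))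

fromIsTadpole : ∀ {G} → IsTadpole G → ∃ λ c → ∃ λ cs → ∃ λ p → ∃ λ ps → Tadpole G c cs p ps
fromIsTadpole {G} (c , cs , p , ps , long , perm , adj) = c , cs , p , ps , record
  { long = long ; perm = perm
  ; adj⁻ = λ a → case Equivalence.to (adj _ _) a of λ where
      (inj₁ m) → [ inj₁ ∘ inj₁ , inj₂ ∘ inj₁ ]′ (split m)
      (inj₂ m) → [ inj₁ ∘ inj₂ , inj₂ ∘ inj₂ ]′ (split m)
  ; adj⁺ = λ where
      (inj₁ (inj₁ m)) → Equivalence.from (adj _ _) (inj₁ (join (inj₁ m)))
      (inj₁ (inj₂ m)) → Equivalence.from (adj _ _) (inj₂ (join (inj₁ m)))
      (inj₂ (inj₁ m)) → Equivalence.from (adj _ _) (inj₁ (join (inj₂ m)))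
      (inj₂ (inj₂ m)) → Equivalence.from (adj _ _) (inj₂ (join (inj₂ m)))
  }
  where
  split : ∀ {d} → d ∈ tadEdges c cs p ps → d ∈ consec (c ∷ cs ++ [ c ]) ⊎ d ∈ consec (c ∷ p ∷ ps)
  split {d} m = ∈-++⁻ (consec (c ∷ cs ++ [ c ])) (subst (d ∈_) (tadEdges-split c cs p ps) m)
  join : ∀ {d} → d ∈ consec (c ∷ cs ++ [ c ]) ⊎ d ∈ consec (c ∷ p ∷ ps) → d ∈ tadEdges c cs p ps
  join {d} s = subst (d ∈_) (sym (tadEdges-split c cs p ps))
    ([ ∈-++⁺ˡ , ∈-++⁺ʳ (consec (c ∷ cs ++ [ c ])) ]′ s)

reverse-cycle : ∀ (c : ℕ) cs → reverse (c ∷ cs ++ [ c ]) ≡ c ∷ reverse cs ++ [ c ]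
reverse-cycle c cs = trans (unfold-reverse c (cs ++ [ c ])) (cong (_++ [ c ]) (reverse-++ cs [ c ]))

-- Serves to orient the cycle according to the rotation at the junction.
Tadpole-reverse : ∀ {G c cs p ps} → Tadpole G c cs p ps → Tadpole G c (reverse cs) p ps
Tadpole-reverse {G} {c} {cs} {p} {ps} t = record
  { long = subst (2 ≤_) (sym (length-reverse cs)) long
  ; perm = ↭-trans perm (prep c (++⁺ʳ (p ∷ ps) (↭-sym (↭-reverse cs))))
  ; adj⁻ = λ a → Sum.map₁ rev (adj⁻ a)
  ; adj⁺ = λ s → adj⁺ (Sum.map₁ rev′ s)
  }
  where
  open Tadpole t
  rev : ∀ {u v} → Step u v (c ∷ cs ++ [ c ]) → Step u v (c ∷ reverse cs ++ [ c ])
  rev s = subst (Step _ _) (reverse-cycle c cs) (step-reverse (c ∷ cs ++ [ c ]) s)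
  rev′ : ∀ {u v} → Step u v (c ∷ reverse cs ++ [ c ]) → Step u v (c ∷ cs ++ [ c ])
  rev′ s = subst (λ k → Step _ _ (c ∷ k ++ [ c ])) (reverse-involutive cs)
    (subst (Step _ _) (reverse-cycle c (reverse cs)) (step-reverse (c ∷ reverse cs ++ [ c ]) s))

hd-init∈ : ∀ l {d x m} → reverse l ≡ x ∷ m → hd (l ++ [ d ]) ∈ l
hd-init∈ []      ()
hd-init∈ (_ ∷ _) _ = here refl

split-consec : ∀ c A B → consec (c ∷ (A ++ B) ++ [ c ]) ≡
  consec (c ∷ A) ++ (lastOf c A , hd (B ++ [ c ])) ∷ consec (B ++ [ c ])
split-consec c A []      rewrite ++-identityʳ A = consec-++ c A c []
split-consec c A (b ∷ B) rewrite ++-assoc A (b ∷ B) [ c ] = consec-++ c A b (B ++ [ c ])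

-- Lets the splits of `cs` stand for the edges of the cycle.
split-at : ∀ {u v} d x l → (u , v) ∈ consec (x ∷ l ++ [ d ]) →
           ∃₂ λ A B → l ≡ A ++ B × (u , v) ≡ (lastOf x A , hd (B ++ [ d ]))
split-at d x []      (here refl) = [] , [] , refl , refl
split-at d x (y ∷ l) (here refl) = [] , y ∷ l , refl , refl
split-at d x (y ∷ l) (there m)   =
  let A , B , eq , eq′ = split-at d y l m in y ∷ A , B , cong (y ∷_) eq , eq′

cycle-first : ∀ c l → 1 ≤ length l → (c , hd l) ∈ consec (c ∷ l ++ [ c ])
cycle-first c (x ∷ l) _ = here refl

cycle-at : ∀ c l {u} → c ∉ l → Step c u (c ∷ l ++ [ c ]) → u ≡ hd l ⊎ u ≡ lastOf c l
cycle-at c []      c∉ (inj₁ (here refl)) = inj₂ refl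
cycle-at c (x ∷ l) c∉ (inj₁ (here refl)) = inj₁ refl
cycle-at c l@(_ ∷ _) c∉ (inj₁ (there m)) = contradiction (consec-src-init l c m) c∉
cycle-at c l       c∉ (inj₂ m) with ∈-++⁻ (consec (c ∷ l)) (subst (_ ∈_) (consec-++ c l c []) m)
... | inj₁ k           = contradiction (consec-tgt c l k) c∉
... | inj₂ (here refl) = inj₂ refl

ends-differ : ∀ c l → 2 ≤ length l → Unique l → lastOf c l ≢ hd l
ends-differ c (x ∷ [])    (s≤s ())
ends-differ c (x ∷ y ∷ l) _ (x∉ ∷ _) eq = All.lookup x∉ (lastOf-∈ y l) (sym eq)

-- Back from the stem the tour turns to the first cycle vertex, by `r₂`; back from the cycle it
-- turns into the stem, by `r₁`. The third turn at the junction belongs to the cycle run backwards.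
cycle-face : ∀ {n} (uq : ∀ x → Unique (n x)) {c p ps} l →
  1 ≤ length l → Seg n c (p ∷ ps) [] → Seg n c l [ c ] → RotThree (n c) (lastOf c l) p (hd l) →
  Unique (loop c (p ∷ ps) ++ consec (c ∷ l ++ [ c ])) →
  Face n (loop c (p ∷ ps) ++ consec (c ∷ l ++ [ c ]))
cycle-face uq (y ∷ l) _ sP sC (rots r₁ r₂ _) u =
  face _ _ refl (loop-then uq sP (turn r₂) (arc-chain uq l sC r₁)) u

-- Vertices and edges of a fixed tadpole.

module _ {G c cs p ps} (t : Tadpole G c cs p ps) where
  open Tadpole t

  private
    n = nb G nothing
    P = p ∷ ps

    uV : Unique ((c ∷ cs) ++ P)
    uV = Permₛ.Unique-resp-↭ (setoid ℕ) (↭⇒↭ₛ perm) (V-unique G)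

    uC : Unique (c ∷ cs)
    uC = proj₁ (unique-++⁻ (c ∷ cs) uV)

    uP : Unique P
    uP = proj₁ (proj₂ (unique-++⁻ (c ∷ cs) uV))

    CP : Disjoint (c ∷ cs) P
    CP = proj₂ (proj₂ (unique-++⁻ (c ∷ cs) uV))

    c∉cs : c ∉ cs
    c∉cs = Unique[x∷xs]⇒x∉xs uC

    ∈cycle : ∀ {v} → v ∈ c ∷ cs ++ [ c ] → v ∈ c ∷ cs
    ∈cycle (here refl) = here refl
    ∈cycle (there m) with ∈-++⁻ cs m
    ... | inj₁ m′          = there m′
    ... | inj₂ (here refl) = here refl

    cycle-ends : ∀ {u v} → Step u v (c ∷ cs ++ [ c ]) → u ∈ c ∷ cs × v ∈ c ∷ cs
    cycle-ends s = Product.map ∈cycle ∈cycle (step-∈ c (cs ++ [ c ]) s)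

    stem-touches : ∀ {u v} → Step u v (c ∷ P) → u ∈ P ⊎ v ∈ P
    stem-touches (inj₁ s) = inj₂ (consec-tgt c P s)
    stem-touches (inj₂ s) = inj₁ (consec-tgt c P s)

    not-both : ∀ {u v} → Step u v (c ∷ cs ++ [ c ]) → ¬ Step u v (c ∷ P)
    not-both s s′ with cycle-ends s | stem-touches s′
    ... | u∈ , _ | inj₁ u∈′ = CP (u∈ , u∈′)
    ... | _ , v∈ | inj₂ v∈′ = CP (v∈ , v∈′)

    ∈V : ∀ {v} → v ∈ c ∷ cs ⊎ v ∈ P → v ∈ V G
    ∈V s = ∈-resp-↭ (↭-sym perm) ([ ∈-++⁺ˡ , ∈-++⁺ʳ (c ∷ cs) ]′ s)

    V∈ : ∀ {v} → v ∈ V G → v ∈ c ∷ cs ⊎ v ∈ P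
    V∈ m = ∈-++⁻ (c ∷ cs) (∈-resp-↭ perm m)

    inV : ∀ {u v} → Adj G u v → v ∈ V G
    inV a with adj⁻ a
    ... | inj₁ s = ∈V (inj₁ (proj₂ (cycle-ends s)))
    ... | inj₂ s with proj₂ (step-∈ c P s)
    ...   | here refl = ∈V (inj₁ (here refl))
    ...   | there m   = ∈V (inj₂ m)

    n⁻ : ∀ {v u} → u ∈ n v → Step v u (c ∷ cs ++ [ c ]) ⊎ Step v u (c ∷ P)
    n⁻ m = adj⁻ (nb⁻ G _ m)

    n⁺ : ∀ {v u} → Step v u (c ∷ cs ++ [ c ]) ⊎ Step v u (c ∷ P) → u ∈ n v
    n⁺ s = nb⁺ G _ (inV (adj⁺ s)) (adj⁺ s)

    c∉P : c ∉ P
    c∉P m = CP (here refl , m)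

  -- Omitting a cycle edge.

  module Skip (A B : List ℕ) (cs≡ : cs ≡ A ++ B) where

    -- The edge between the two parts of the cycle; it starts at `c` if `A` is empty and ends at `c`
    -- if `B` is empty.
    e : Dart
    e = lastOf c A , hd (B ++ [ c ])

    nE : ℕ → List ℕ
    nE = nb G (just e)

    private
      edges : consec (c ∷ cs ++ [ c ]) ≡ consec (c ∷ A) ++ e ∷ consec (B ++ [ c ])
      edges = trans (cong (λ k → consec (c ∷ k ++ [ c ])) cs≡) (split-consec c A B)

      e∈ : Step (proj₁ e) (proj₂ e) (c ∷ cs ++ [ c ])
      e∈ = inj₁ (subst (e ∈_) (sym edges) (∈-insert (consec (c ∷ A))))

      e-step : ∀ {v u} → Same e (v , u) → Step v u (c ∷ cs ++ [ c ])
      e-step (inj₁ refl) = e∈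
      e-step (inj₂ refl) = step-sym e∈

      apart : (∀ {d} → d ∈ consec (c ∷ A) → ¬ Same e d) × (∀ {d} → d ∈ consec (B ++ [ c ]) → ¬ Same e d)
      apart = differ-mid (consec (c ∷ A)) (subst (AllPairs Differ) edges (cycle-differ c cs long uC))

      rev : reverse (B ++ [ c ]) ≡ c ∷ reverse B
      rev = reverse-++ B [ c ]

      rev′ : reverse (c ∷ reverse B) ≡ B ++ [ c ]
      rev′ = trans (cong reverse (sym rev)) (reverse-involutive (B ++ [ c ]))

      cycle⁻ : ∀ {d} → d ∈ consec (c ∷ cs ++ [ c ]) → ¬ Same e d →
               d ∈ consec (c ∷ A) ⊎ d ∈ consec (B ++ [ c ])
      cycle⁻ {d} m ¬s with ∈-++⁻ (consec (c ∷ A)) (subst (d ∈_) edges m)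
      ... | inj₁ m′           = inj₁ m′
      ... | inj₂ (here refl)  = contradiction (inj₁ refl) ¬s
      ... | inj₂ (there m′)   = inj₂ m′

      cycle⁺ : ∀ {d} → d ∈ consec (c ∷ A) ⊎ d ∈ consec (B ++ [ c ]) → d ∈ consec (c ∷ cs ++ [ c ])
      cycle⁺ {d} s = subst (d ∈_) (sym edges)
        ([ ∈-++⁺ˡ , ∈-++⁺ʳ (consec (c ∷ A)) ∘ there ]′ s)

      turnB : ∀ {v u} → Step v u (B ++ [ c ]) → Step v u (c ∷ reverse B)
      turnB s = subst (Step _ _) rev (step-reverse (B ++ [ c ]) s)

      turnB′ : ∀ {v u} → Step v u (c ∷ reverse B) → Step v u (B ++ [ c ])
      turnB′ s = subst (Step _ _) rev′ (step-reverse (c ∷ reverse B) s)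

      -- `B` is reversed because a leg is read outwards from the junction.
      nE⁻ : ∀ {v u} → u ∈ nE v → Step v u (c ∷ P) ⊎ Step v u (c ∷ A) ⊎ Step v u (c ∷ reverse B)
      nE⁻ {v} {u} m with nbE⁻ G v e m
      ... | m′ , ¬s with n⁻ m′
      ...   | inj₂ s        = inj₁ s
      ...   | inj₁ (inj₁ s) = inj₂ ([ inj₁ ∘ inj₁ , inj₂ ∘ turnB ∘ inj₁ ]′ (cycle⁻ s ¬s))
      ...   | inj₁ (inj₂ s) = inj₂ ([ inj₁ ∘ inj₂ , inj₂ ∘ turnB ∘ inj₂ ]′ (cycle⁻ s (¬s ∘ Same-swap)))

      apart-step : ∀ {v u} → Step v u (c ∷ A) ⊎ Step v u (B ++ [ c ]) →
                   Step v u (c ∷ cs ++ [ c ]) × ¬ Same e (v , u)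
      apart-step (inj₁ (inj₁ m)) = inj₁ (cycle⁺ (inj₁ m)) , proj₁ apart m
      apart-step (inj₁ (inj₂ m)) = inj₂ (cycle⁺ (inj₁ m)) , proj₁ apart m ∘ Same-swap
      apart-step (inj₂ (inj₁ m)) = inj₁ (cycle⁺ (inj₂ m)) , proj₂ apart m
      apart-step (inj₂ (inj₂ m)) = inj₂ (cycle⁺ (inj₂ m)) , proj₂ apart m ∘ Same-swap

      nE⁺ : ∀ {v u} → Step v u (c ∷ P) ⊎ Step v u (c ∷ A) ⊎ Step v u (c ∷ reverse B) → u ∈ nE v
      nE⁺ {v} (inj₁ s) = nbE⁺ G v e (n⁺ (inj₂ s)) (λ sm → not-both (e-step sm) s)
      nE⁺ {v} (inj₂ s) = let s′ , ¬s = apart-step (Sum.map₂ turnB′ s) in nbE⁺ G v e (n⁺ (inj₁ s′)) ¬s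

      uAB : Unique A × Unique B × Disjoint A B
      uAB = unique-++⁻ A (subst Unique cs≡ (proj₂ (unique-++⁻ [ c ] uC) .proj₁))

      A⊆ : ∀ {v} → v ∈ A → v ∈ cs
      A⊆ {v} m = subst (v ∈_) (sym cs≡) (∈-++⁺ˡ m)

      rB⊆B : ∀ {v} → v ∈ reverse B → v ∈ B
      rB⊆B = ∈-resp-↭ (↭-reverse B)

      B⊆ : ∀ {v} → v ∈ reverse B → v ∈ cs
      B⊆ {v} m = subst (v ∈_) (sym cs≡) (∈-++⁺ʳ A (rB⊆B m))

      uE : ∀ x → Unique (nE x)
      uE x = nbE-unique G x e

    open Spider {nE} c p ps A (reverse B)
      (unique-∷ c∉P uP)
      (unique-∷ (c∉cs ∘ A⊆) (proj₁ uAB))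
      (unique-∷ (c∉cs ∘ B⊆) (Permₛ.Unique-resp-↭ (setoid ℕ) (↭⇒↭ₛ (↭-sym (↭-reverse B))) (proj₁ (proj₂ uAB))))
      (λ (x , y) → CP (there (A⊆ y) , x))
      (λ (x , y) → CP (there (B⊆ y) , x))
      (λ (x , y) → proj₂ (proj₂ uAB) (x , rB⊆B y))
      nE⁻ nE⁺ public

    private
      parts : ∀ {v} → v ∈ V G → v ∈ c ∷ P ⊎ v ∈ A ⊎ v ∈ reverse B
      parts m with V∈ m
      ... | inj₂ m′          = inj₁ (there m′)
      ... | inj₁ (here refl) = inj₁ (here refl)
      ... | inj₁ (there m′) with ∈-++⁻ A (subst (_ ∈_) cs≡ m′)
      ...   | inj₁ k = inj₂ (inj₁ k)
      ...   | inj₂ k = inj₂ (inj₂ (∈-resp-↭ (↭-sym (↭-reverse B)) k))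

      parts⁻ : ∀ {v} → v ∈ c ∷ P ⊎ v ∈ A ⊎ v ∈ reverse B → v ∈ V G
      parts⁻ (inj₁ (here refl)) = ∈V (inj₁ (here refl))
      parts⁻ (inj₁ (there m))   = ∈V (inj₂ m)
      parts⁻ (inj₂ (inj₁ m))    = ∈V (inj₁ (there (A⊆ m)))
      parts⁻ (inj₂ (inj₂ m))    = ∈V (inj₁ (there (B⊆ m)))

    -- Not using `e`, the tour stays on the spider, all of whose edges are bridges.
    tree-bound : ∀ {s r} → ClosedTour G s r → (∀ {d} → d ∈ consec (s ∷ r) → ¬ Same e d) →
                 sumW G tree ≤ℚ cost G (s ∷ r)
    tree-bound {s} {r} (linked , closed , all) unused =
      subst (sumW G tree ≤ℚ_) (sym (cost-consec G (s ∷ r)))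
        (sumW-⊆ G tree-unique (tree⊆tour closed (All.lookup all ∘ parts⁻) adj))
      where
      adj : ∀ {a b} → (a , b) ∈ consec (s ∷ r) → b ∈ nE a × a ∈ nE b
      adj {a} {b} m = b∈ , nbE-sym G e inV b∈
        where
        ab : Adj G a b
        ab = consec-linked (s ∷ r) linked m
        b∈ = nbE⁺ G a e (nb⁺ G a (inV ab) ab) (unused m)

    private
      cs-nonempty : cs ≢ []
      cs-nonempty eq with subst (λ k → 2 ≤ length k) eq long
      ... | ()

      src∈ : ∀ {y A′} → A ≡ y ∷ A′ → proj₁ e ∈ A
      src∈ refl = lastOf-∈ _ _

      tgt∈ : ∀ {x B′} → reverse B ≡ x ∷ B′ → proj₂ e ∈ B
      tgt∈ = hd-init∈ B

      src≢tgt : proj₁ e ≢ proj₂ e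
      src≢tgt = distinct A B cs≡ refl refl
        where
        -- Copies of `A` and `B`, tied to them by equations, allow case analysis on the module
        -- parameters.
        distinct : ∀ A′ B′ → cs ≡ A′ ++ B′ → A′ ≡ A → B′ ≡ B → lastOf c A′ ≢ hd (B′ ++ [ c ])
        distinct []      []      eq _ _ _ = cs-nonempty eq
        distinct (y ∷ A′) []     refl _ _ eq =
          c∉cs (subst (_∈ cs) eq (∈-++⁺ˡ (lastOf-∈ y A′)))
        distinct A′ (b ∷ B′) refl refl refl eq with subst (_∈ c ∷ A′) eq (lastOf-∈ c A′)
        ... | here refl = c∉cs (∈-insert A′)
        ... | there m   = proj₂ (proj₂ uAB) (m , here refl)

      -- A tree has one edge less than vertices, and each edge gives two darts.
      length-eq : suc (suc (length tree)) ≡ length (V G) + length (V G)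
      length-eq = trans (cong (suc ∘ suc) (trans tree-length
          (cong (λ k → (length P + length P) + ((length A + length A) + (k + k))) (length-reverse B))))
        (trans (count (length P) (length A) (length B)) (cong (λ k → k + k) (sym sizeV)))
        where
        count : ∀ x a b → suc (suc ((x + x) + ((a + a) + (b + b)))) ≡ suc (a + b) + x + (suc (a + b) + x)
        count = solve-∀
        sizeV : length (V G) ≡ suc (length A + length B) + length P
        sizeV = trans (↭-length perm) (trans (length-++ (c ∷ cs))
          (cong (λ k → suc k + length P) (trans (cong length cs≡) (length-++ A))))

      onlyA : ∀ {y A′} → A ≡ y ∷ A′ → reverse B ≡ [] → Node nE c p y
      onlyA {y} eqA eqB = nE⁺ (inj₁ (inj₁ (here refl)))
        , nE⁺ (inj₂ (inj₁ (subst (λ k → Step c y (c ∷ k)) (sym eqA) (inj₁ (here refl)))))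
        , λ m → case centre m of λ where
            (inj₁ eq)              → inj₁ eq
            (inj₂ (inj₁ (_ , eq))) → inj₂ (cong hd (trans (sym eq) eqA))
            (inj₂ (inj₂ (_ , eq))) → case trans (sym eq) eqB of λ ()

      onlyB : ∀ {x B′} → A ≡ [] → reverse B ≡ x ∷ B′ → Node nE c p x
      onlyB {x} eqA eqB = nE⁺ (inj₁ (inj₁ (here refl)))
        , nE⁺ (inj₂ (inj₂ (subst (λ k → Step c x (c ∷ k)) (sym eqB) (inj₁ (here refl)))))
        , λ m → case centre m of λ where
            (inj₁ eq)              → inj₁ eq
            (inj₂ (inj₂ (_ , eq))) → inj₂ (cong hd (trans (sym eq) eqB))
            (inj₂ (inj₁ (_ , eq))) → case trans (sym eq) eqA of λ ()

      some : 1 ≤ length A + length (reverse B)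
      some = subst (1 ≤_) (trans (cong length cs≡) (trans (length-++ A) (cong (length A +_) (sym (length-reverse B)))))
        (≤-trans (s≤s z≤n) long)

    module _ (ori : RotThree (n c) (lastOf c cs) p (hd cs)) where

      private
        -- With both parts of the cycle nonempty, `e` does not meet `c`, and the rotation at `c` is
        -- that of the full graph.
        both : ∀ {y A′ x B′} → A ≡ y ∷ A′ → reverse B ≡ x ∷ B′ → RotThree (nE c) p y x
        both {y} {A′} {x} {B′} eqA eqB = rots (keep r₁) (keep r₂) (keep r₃)
          where
          c-free : ∀ {u} → ¬ Same e (c , u)
          c-free (inj₁ eq) = c∉cs (A⊆ (subst (_∈ A) (sym (cong proj₁ eq)) (src∈ eqA)))
          c-free (inj₂ eq) = c∉cs (subst (c ∈_) (sym cs≡)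
            (∈-++⁺ʳ A (subst (_∈ B) (sym (cong proj₁ eq)) (tgt∈ eqB))))
          keep : ∀ {u v} → rot u (n c) ≡ v → rot u (nE c) ≡ v
          keep = trans (rot-nbE G e c-free c-free)
          head : hd cs ≡ y
          head = cong hd (trans cs≡ (cong (_++ B) eqA))
          last : lastOf c cs ≡ x
          last = trans (cong (lastOf c) (trans cs≡ (trans (cong (A ++_)
              (trans (sym (reverse-involutive B)) (trans (cong reverse eqB) (unfold-reverse x B′))))
              (sym (++-assoc A (reverse B′) [ x ])))))
            (lastOf-∷ʳ c (A ++ reverse B′) x)
          open RotThree (rot-cycle (subst (λ k → RotThree (n c) k p y) last
            (subst (RotThree (n c) (lastOf c cs) p) head ori))) renaming (rot-a to r₁; rot-b to r₂; rot-c to r₃)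

      achieve-tree : ∀ {s} → s ∈ V G → Achieves G s (sumW G tree)
      achieve-tree s∈ = achieve-skip G e inV s∈
        (tree-face uE A (reverse B) segP segA segB tree-unique both onlyA onlyB some)
        tree⁻ tree⁺ (tree-cover ∘ parts) src≢tgt (adj⁺ (inj₁ e∈)) length-eq

  -- The tour around the cycle.

  private
    arc : List Dart
    arc = consec (c ∷ cs ++ [ c ])

  cycleTour : List Dart
  cycleTour = loop c P ++ arc

  private
    arc-away : ∀ {u v} → (u , v) ∈ arc → u ∉ P × v ∉ P
    arc-away m = let u∈ , v∈ = cycle-ends (inj₁ m) in (λ k → CP (u∈ , k)) , (λ k → CP (v∈ , k))

    arc-differ : AllPairs Differ arc
    arc-differ = cycle-differ c cs long uC

    cycleTour-unique : Unique cycleTour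
    cycleTour-unique = Unique.++⁺ (loop-unique c P (unique-∷ c∉P uP))
      (AllPairs.map (λ d≁ eq → d≁ (inj₁ (sym eq))) arc-differ) (loop-disjoint c P arc-away)

    stem-from : ∀ {v u} → v ∈ P → u ∈ n v → Step v u (c ∷ P)
    stem-from m m′ with n⁻ m′
    ... | inj₁ s = contradiction (proj₁ (cycle-ends s) , m) CP
    ... | inj₂ s = s

    stem-seg : Seg n c P []
    stem-seg = leg c P (unique-∷ c∉P uP) stem-from (λ _ → n⁺ ∘ inj₂)

    cycle-seg : Seg n c cs [ c ]
    cycle-seg = seg-build c cs [ c ] uC (unique-∷ʳ uC) from (λ _ → n⁺ ∘ inj₁)
      where
      from : ∀ {v u} → v ∈ cs → u ∈ n v → Step v u (c ∷ cs ++ [ c ])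
      from m m′ with n⁻ m′
      ... | inj₁ s = s
      ... | inj₂ s with proj₁ (step-∈ c P s)
      ...   | here refl = contradiction m c∉cs
      ...   | there k   = contradiction (there m , k) CP

    hd-step : (c , hd cs) ∈ arc
    hd-step = cycle-first c cs (≤-trans (s≤s z≤n) long)

    last-step : (lastOf c cs , c) ∈ arc
    last-step = subst ((lastOf c cs , c) ∈_) (sym (consec-++ c cs c [])) (∈-insert (consec (c ∷ cs)))

    junction : ∀ {u} → u ∈ n c → u ∈ lastOf c cs ∷ p ∷ hd cs ∷ []
    junction m with n⁻ m
    ... | inj₂ s = there (here (sym (cong hd (proj₂ (step-head P c∉P s)))))
    ... | inj₁ s with cycle-at c cs c∉cs s
    ...   | inj₁ refl = there (there (here refl))
    ...   | inj₂ refl = here refl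

  orientation : RotThree (n c) (lastOf c cs) p (hd cs) ⊎ RotThree (n c) (hd cs) p (lastOf c cs)
  orientation = rot-three (nb-unique G c) (n⁺ (inj₁ (inj₂ last-step))) (n⁺ (inj₂ (inj₁ (here refl))))
    (n⁺ (inj₁ (inj₁ hd-step)))
    (λ eq → CP (proj₁ (cycle-ends (inj₁ last-step)) , here eq))
    (ends-differ c cs long (proj₁ (proj₂ (unique-++⁻ [ c ] uC))))
    (λ eq → CP (proj₂ (cycle-ends (inj₁ hd-step)) , here (sym eq)))
    junction

  achieve-cycle : RotThree (n c) (lastOf c cs) p (hd cs) → ∀ {s} → s ∈ V G → Achieves G s (sumW G cycleTour)
  achieve-cycle ori {s} s∈ = achieve-face G (nonempty s∈)
    (cycle-face (nb-unique G) cs (≤-trans (s≤s z≤n) long) stem-seg cycle-seg ori cycleTour-unique) sound cover (start (V∈ s∈))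
    where
    open RotThree ori
    nonempty : ∀ {l} → s ∈ l → 1 ≤ length l
    nonempty (here _)  = s≤s z≤n
    nonempty (there _) = s≤s z≤n
    sound : ∀ {u v} → (u , v) ∈ cycleTour → Adj G u v
    sound m with ∈-++⁻ (loop c P) m
    ... | inj₁ m′ = adj⁺ (inj₂ (loop⁻ c P m′))
    ... | inj₂ m′ = adj⁺ (inj₁ (inj₁ m′))
    cover : Covers G cycleTour
    cover m with V∈ m
    ... | inj₂ m′          = let u , k = consec-cover c P m′ in u , ∈-++⁺ˡ (loop⁺ c P (inj₁ k))
    ... | inj₁ (here refl) = p , ∈-++⁺ˡ (loop⁺ c P (inj₂ (here refl)))
    ... | inj₁ (there m′)  =
      let u , k = consec-cover c (cs ++ [ c ]) (∈-++⁺ˡ m′) in u , ∈-++⁺ʳ (loop c P) k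
    -- On the stem every dart belongs to the tour. At `c` only the dart to the last cycle vertex is
    -- missing, and its successor leads into the stem. At any other cycle vertex one of the two
    -- darts belongs to the tour.
    start : s ∈ c ∷ cs ⊎ s ∈ P → (s , hd (n s)) ∈ cycleTour ⊎ (s , rot (hd (n s)) (n s)) ∈ cycleTour
    start (inj₂ m) = inj₁ (∈-++⁺ˡ (loop⁺ c P (stem-from m (hd∈ (n⁺ (inj₂ (step-sym (inj₁ (proj₂ (consec-cover c P m))))))))))
    start (inj₁ (here refl)) with junction (hd∈ (n⁺ (inj₂ (inj₁ (here refl)))))
    ... | here eq = inj₂ (subst (λ k → (c , k) ∈ cycleTour)
            (sym (trans (cong (λ k → rot k (n c)) eq) rot-a)) (here refl))
    ... | there (here eq)         = inj₁ (subst (λ k → (c , k) ∈ cycleTour) (sym eq) (here refl))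
    ... | there (there (here eq)) = inj₁ (subst (λ k → (c , k) ∈ cycleTour) (sym eq) (∈-++⁺ʳ (loop c P) hd-step))
    start (inj₁ (there m)) with seg-node cs cycle-seg m
    ... | a , b , nd@(_ , b∈ , only) , sb with only (hd∈ b∈)
    ...   | inj₂ eq = inj₁ (subst (λ k → (s , k) ∈ cycleTour) (sym eq) (∈-++⁺ʳ (loop c P) sb))
    ...   | inj₁ eq = inj₂ (subst (λ k → (s , k) ∈ cycleTour)
              (sym (trans (cong (λ k → rot k (n s)) eq) (rot-node {n} (nb-unique G s) nd)))
              (∈-++⁺ʳ (loop c P) sb))

  -- `orient` gives each cycle edge a direction in which the tour traverses it; weights are
  -- symmetric, so the sum is kept. Distinct edges give distinct darts, and the stem edges, being
  -- bridges, are used both ways.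
  cycle-bound : ∀ {s r} → ClosedTour G s r →
    (∀ {d} → d ∈ arc → d ∈ consec (s ∷ r) ⊎ swap d ∈ consec (s ∷ r)) →
    sumW G cycleTour ≤ℚ cost G (s ∷ r)
  cycle-bound {s} {r} (linked , closed , all) used =
    subst (_≤ℚ cost G (s ∷ r)) sums
      (subst (sumW G (loop c P ++ map orient arc) ≤ℚ_) (sym (cost-consec G (s ∷ r))) (sumW-⊆ G unique sub))
    where
    W = consec (s ∷ r)
    orient : Dart → Dart
    orient d with d ∈? W
    ... | yes _ = d
    ... | no  _ = swap d
    orient-same : ∀ d → orient d ≡ d ⊎ orient d ≡ swap d
    orient-same d with d ∈? W
    ... | yes _ = inj₁ refl
    ... | no  _ = inj₂ refl
    orient∈ : ∀ {d} → d ∈ arc → orient d ∈ W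
    orient∈ {d} m with d ∈? W | used m
    ... | yes k | _      = k
    ... | no ¬k | inj₁ k = contradiction k ¬k
    ... | no ¬k | inj₂ k = k
    orient-weight : ∀ D → sumW G (map orient D) ≡ sumW G D
    orient-weight []            = refl
    orient-weight ((u , v) ∷ D) with (u , v) ∈? W
    ... | yes _ = cong (weight G u v +ℚ_) (orient-weight D)
    ... | no  _ = cong₂ _+ℚ_ (cong (fromMaybe 0ℚ) (w-sym G v u)) (orient-weight D)
    orient-differ : ∀ {d d′} → Differ d d′ → orient d ≢ orient d′
    orient-differ {d} {d′} d≁ eq with orient-same d | orient-same d′
    ... | inj₁ p | inj₁ q = d≁ (inj₁ (trans (sym q) (trans (sym eq) p)))
    ... | inj₁ p | inj₂ q = d≁ (inj₂ (cong swap (trans (sym q) (trans (sym eq) p))))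
    ... | inj₂ p | inj₁ q = d≁ (inj₂ (trans (sym q) (trans (sym eq) p)))
    ... | inj₂ p | inj₂ q = d≁ (inj₁ (cong swap (trans (sym q) (trans (sym eq) p))))
    sums : sumW G (loop c P ++ map orient arc) ≡ sumW G cycleTour
    sums = trans (sumW-++ G (loop c P) (map orient arc))
      (trans (cong (sumW G (loop c P) +ℚ_) (orient-weight arc)) (sym (sumW-++ G (loop c P) arc)))
    away : ∀ {u v} → (u , v) ∈ map orient arc → u ∉ P × v ∉ P
    away m with ∈-map⁻ orient m
    ... | d , d∈ , eq with orient-same d
    ...   | inj₁ p with refl ← trans eq p = arc-away d∈
    ...   | inj₂ p with refl ← trans eq p = swap (arc-away d∈)
    unique : Unique (loop c P ++ map orient arc)
    unique = Unique.++⁺ (loop-unique c P (unique-∷ c∉P uP))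
      (AllPairs.map⁺ (AllPairs.map orient-differ arc-differ)) (loop-disjoint c P away)
    adj : ∀ {a b} → (a , b) ∈ W → b ∈ n a × a ∈ n b
    adj {a} {b} m = nb⁺ G a (inV ab) ab , nb⁺ G b (inV (Adj-sym G ab)) (Adj-sym G ab)
      where ab = consec-linked (s ∷ r) linked m
    sub : ∀ {d} → d ∈ loop c P ++ map orient arc → d ∈ W
    sub m with ∈-++⁻ (loop c P) m
    ... | inj₁ k = loop⊆tour c P (unique-∷ c∉P uP) stem-seg closed
            (λ { (here refl) → All.lookup all (∈V (inj₁ (here refl))) ; (there j) → All.lookup all (∈V (inj₂ j)) })
            adj k
    ... | inj₂ k with ∈-map⁻ orient k
    ...   | d , d∈ , refl = orient∈ d∈

  lower-bound : ∀ {s r} → ClosedTour G s r → sumW G cycleTour ≤ℚ cost G (s ∷ r) ⊎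
    (∃₂ λ A B → Σ (cs ≡ A ++ B) λ eq → sumW G (Skip.tree A B eq) ≤ℚ cost G (s ∷ r))
  lower-bound {s} {r} tour with all? (λ d → (d ∈? consec (s ∷ r)) ⊎-dec (swap d ∈? consec (s ∷ r))) arc
  ... | yes used = inj₁ (cycle-bound tour (All.lookup used))
  ... | no ¬used with find (¬All⇒Any¬ (λ d → (d ∈? consec (s ∷ r)) ⊎-dec (swap d ∈? consec (s ∷ r))) arc ¬used)
  ...   | d , d∈ , unused with split-at c c cs d∈
  ...     | A , B , eq , refl = inj₂ (A , B , eq , Skip.tree-bound A B eq tour
              (λ { m (inj₁ refl) → unused (inj₁ m) ; m (inj₂ refl) → unused (inj₂ m) }))

-- Choosing the cheapest tour.

last-reverse : ∀ c l → 1 ≤ length l → lastOf c (reverse l) ≡ hd l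
last-reverse c (x ∷ l) _ = trans (cong (lastOf c) (unfold-reverse x l)) (lastOf-∷ʳ c (reverse l) x)

hd-reverse : ∀ c l → 1 ≤ length l → hd (reverse l) ≡ lastOf c l
hd-reverse c l 1≤ = trans (sym (last-reverse c (reverse l) (subst (1 ≤_) (sym (length-reverse l)) 1≤)))
  (cong (lastOf c) (reverse-involutive l))

-- Induction on the list: the split with empty first part is compared with the best of those whose
-- first part begins with `x`.
best-split : ∀ (f : List ℕ → List ℕ → ℚ) l →
  ∃₂ λ A B → l ≡ A ++ B × (∀ A′ B′ → l ≡ A′ ++ B′ → f A B ≤ℚ f A′ B′)
best-split f [] = [] , [] , refl , λ { [] [] refl → ℚ.≤-refl }
best-split f (x ∷ l) with best-split (f ∘ (x ∷_)) l
... | A , B , refl , best with ℚ.≤-total (f (x ∷ A) B) (f [] (x ∷ A ++ B))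
...   | inj₁ le = x ∷ A , B , refl , λ where
        []       B′ refl → le
        (_ ∷ A′) B′ eq   → case ∷-injective eq of λ { (refl , eq′) → best A′ B′ eq′ }
...   | inj₂ le = [] , x ∷ A ++ B , refl , λ where
        []       B′ refl → ℚ.≤-refl
        (_ ∷ A′) B′ eq   → case ∷-injective eq of λ { (refl , eq′) → ℚ.≤-trans le (best A′ B′ eq′) }

-- `q` is the smaller of the cost around the cycle and the least cost of a tree tour; by
-- `lower-bound` every closed tour costs at least one of the candidates.
oriented-optimal : ∀ {G c cs p ps} (t : Tadpole G c cs p ps) →
  RotThree (nb G nothing c) (lastOf c cs) p (hd cs) → ∀ {s} → s ∈ V G →
  ∃[ q ] (Achieves G s q × (∀ {r} → ClosedTour G s r → q ≤ℚ cost G (s ∷ r)))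
oriented-optimal {G} {c} {cs} {p} {ps} t ori s∈ = choose (best-split treeSum cs)
  where
  -- Formed without a proof of `cs ≡ A ++ B`, so that `best-split` applies; at a split it is the
  -- weight of `Skip.tree` by definition.
  treeSum : List ℕ → List ℕ → ℚ
  treeSum A B = sumW G (loop c (p ∷ ps) ++ loop c A ++ loop c (reverse B))
  choose : (∃₂ λ A B → cs ≡ A ++ B × (∀ A′ B′ → cs ≡ A′ ++ B′ → treeSum A B ≤ℚ treeSum A′ B′)) →
    ∃[ q ] (Achieves G _ q × (∀ {r} → ClosedTour G _ r → q ≤ℚ cost G (_ ∷ r)))
  choose (A , B , eq , best) with ℚ.≤-total (sumW G (cycleTour t)) (treeSum A B)
  ... | inj₁ le = sumW G (cycleTour t) , achieve-cycle t ori s∈ , λ tour → case lower-bound t tour of λ where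
          (inj₁ b)                  → b
          (inj₂ (A′ , B′ , eq′ , b)) → ℚ.≤-trans le (ℚ.≤-trans (best A′ B′ eq′) b)
  ... | inj₂ le = treeSum A B , Skip.achieve-tree t A B eq ori s∈ , λ tour → case lower-bound t tour of λ where
          (inj₁ b)                  → ℚ.≤-trans le b
          (inj₂ (A′ , B′ , eq′ , b)) → ℚ.≤-trans (best A′ B′ eq′) b

optimal : ∀ {G c cs p ps} → Tadpole G c cs p ps → ∀ {s} → s ∈ V G →
  ∃[ q ] (Achieves G s q × (∀ {r} → ClosedTour G s r → q ≤ℚ cost G (s ∷ r)))
optimal {G} {c} {cs} {p} t s∈ with orientation t
... | inj₁ ori = oriented-optimal t ori s∈
-- Reversing the cycle exchanges its first and last vertex, which turns this cyclic order at the
-- junction into the required one.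
... | inj₂ ori = oriented-optimal (Tadpole-reverse t) (reversed cs (≤-trans (s≤s z≤n) (Tadpole.long t)) ori) s∈
  where
  reversed : ∀ l → 1 ≤ length l → RotThree (nb G nothing c) (hd l) p (lastOf c l) →
             RotThree (nb G nothing c) (lastOf c (reverse l)) p (hd (reverse l))
  reversed l 1≤ = subst (λ k → RotThree (nb G nothing c) k p (hd (reverse l))) (sym (last-reverse c l 1≤))
    ∘ subst (RotThree (nb G nothing c) (hd l) p) (sym (hd-reverse c l 1≤))

theorem5 : Σ Algorithm λ A → ∀ (G : WGraph) → IsTadpole G → ∀ s → s ∈ V G →
    ∃[ a ] ((length a ≡ adviceBits (length (V G))) × ExploresOptimally A a G s)
theorem5 = explore , λ G tad s s∈ → case fromIsTadpole tad of λ where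
  (_ , _ , _ , _ , t) → case optimal t s∈ of λ where
    (q , (a , len , fuel , rest , ran , tour , le) , least) →
      a , len , fuel , rest , ran , tour , λ rest′ tour′ → ℚ.≤-trans le (least tour′)
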